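{- Let $n\ge 2$ and $0\le k\le n$. The number of Boolean intervals of rank $k$ in the right weak order of the Coxeter group of type $C_n$ is $$2^{n-k}\, n!\binom{n+1-k}{k}.$$
   Context: Type $C_n$: generators $s_1,\ldots,s_n$ with $m(s_i,s_{i+1})=3$ for $i\le n-2$, $m(s_{n-1},s_n)=4$, $m(s_i,s_j)=2$ for $|i-j|>1$; it has order $2^n n!$. Right weak order: $u\le w$ iff $\ell(w)=\ell(u)+\ell(u^{ -1}w)$. A Boolean interval of rank $k$ is an interval isomorphic to the lattice of subsets of a $k$-element set. -}

module Defs where

open import Data.Nat using (ℕ; zero; suc; _+_; _≤_; _<?_)
open import Data.Nat.Base using (_≡ᵇ_)
open import Data.Bool using (Bool; true; false; if_then_else_; not; _xor_)
open import Data.Fin using (Fin; toℕ; fromℕ<)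
open import Data.Fin.Subset using (Subset; _⊆_)
open import Data.Vec using (Vec; tabulate; lookup)
open import Data.List using (List; foldl; length)
open import Data.List.Relation.Unary.Unique.Propositional using (Unique)
open import Data.List.Membership.Propositional using (_∈_)
open import Data.Product using (Σ; _×_; _,_; proj₁; proj₂)
open import Relation.Nullary using (yes; no)
open import Relation.Binary.PropositionalEquality using (_≡_)

-- A signed value ±j : (true = negative sign, j).
SVal : ℕ → Set
SVal n = Bool × Fin n

-- Elements of the hyperoctahedral group in window notation:
-- w is stored as the vector (w(1), …, w(n)) of signed values.
Window : ℕ → Set
Window n = Vec (SVal n) n

identity : {n : ℕ} → Window n
identity = tabulate (λ j → false , j)

-- composition: (u v)(i) = u(v(i)), with u(-j) = -u(j)
compose : {n : ℕ} → Window n → Window n → Window n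
compose u v = tabulate (λ i →
  (proj₁ (lookup v i) xor proj₁ (lookup u (proj₂ (lookup v i))))
  , proj₂ (lookup u (proj₂ (lookup v i))))

-- Right multiplication w ↦ w s_i by the Coxeter generator s_i of type C_n,
-- generators indexed by Fin n (0-based):  for toℕ i + 1 < n, s_i is the
-- transposition of positions i, i+1; the last generator negates the last
-- position.  (m(s_i,s_{i+1}) = 3, m(s_{n-2}, s_{n-1}) = 4, others 2.)
rmul : {n : ℕ} → Window n → Fin n → Window n
rmul {n} w i with suc (toℕ i) <? n
... | yes p = tabulate (λ j → lookup w (τ j))
  where
  τ : Fin n → Fin n
  τ j = if toℕ j ≡ᵇ toℕ i then fromℕ< p
        else if toℕ j ≡ᵇ suc (toℕ i) then i else j
... | no _ = tabulate (λ j →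
  (if toℕ j ≡ᵇ toℕ i then not (proj₁ (lookup w j)) else proj₁ (lookup w j))
  , proj₂ (lookup w j))

eval : {n : ℕ} → List (Fin n) → Window n
eval = foldl rmul identity

HasLength : {n : ℕ} → Window n → ℕ → Set
HasLength {n} w m =
  (Σ (List (Fin n)) λ ws → length ws ≡ m × eval ws ≡ w)
  × ((ws : List (Fin n)) → eval ws ≡ w → m ≤ length ws)

InW : {n : ℕ} → Window n → Set
InW w = Σ ℕ (HasLength w)

-- right weak order: u ≤ w iff ℓ(w) = ℓ(u) + ℓ(u⁻¹ w), where v = u⁻¹ w is
-- the (unique) element with u v = w.
_≤R_ : {n : ℕ} → Window n → Window n → Set
_≤R_ {n} u w = Σ (Window n) λ v → compose u v ≡ w ×
  Σ ℕ λ a → Σ ℕ λ b → Σ ℕ λ c →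
    HasLength u a × HasLength v b × HasLength w c × c ≡ a + b

IsBooleanInterval : {n : ℕ} → ℕ → Window n → Window n → Set
IsBooleanInterval {n} k u w =
  (u ≤R w) ×
  Σ (Window n → Subset k) λ f → Σ (Subset k → Window n) λ g →
    ((S : Subset k) → (u ≤R g S) × (g S ≤R w)) ×
    ((S : Subset k) → f (g S) ≡ S) ×
    ((v : Window n) → u ≤R v → v ≤R w → g (f v) ≡ v) ×
    ((v v′ : Window n) → u ≤R v → v ≤R w → u ≤R v′ → v′ ≤R w →
       (v ≤R v′ → f v ⊆ f v′) × (f v ⊆ f v′ → v ≤R v′))

NumberOf : {A : Set} → (A → Set) → ℕ → Set
NumberOf {A} P N = Σ (List A) λ xs → Unique xs × length xs ≡ N ×
  ((a : A) → (P a → a ∈ xs) × (a ∈ xs → P a))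

BooleanIntervalC : (n k : ℕ) → Window n × Window n → Set
BooleanIntervalC n k (u , w) = InW u × InW w × IsBooleanInterval k u w

{-# OPTIONS --safe #-}

-- Identify the length of a signed permutation with its number of inversions, so
-- that the descents of w can be read off neighbouring entries of the window.
-- The atoms u s of a Boolean interval [u, w] commute pairwise, since two
-- adjacent generators generate a rank two interval of length at least three;
-- hence w = u w_J, where J is a set of k pairwise non-adjacent nodes of the
-- diagram avoiding the descents of u. Conversely every such pair (u, J) gives a
-- Boolean interval. There are C(n+1-k, k) such sets J, and for each of them the
-- involutions u ↦ u s, s ∈ J, each halve the 2^n n! elements of the group, which
-- leaves 2^(n-k) n! choices of u.
module Submission where

open import Defs
open import Data.Nat using (ℕ; zero; suc; _+_; _*_; _∸_; _^_; _≤_; _<_; _<ᵇ_; _<?_; _!; z≤n; s≤s)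
open import Data.Nat.Base using (_≡ᵇ_)
open import Data.Nat.Combinatorics using (_C_; nCk+nC[k+1]≡[n+1]C[k+1])
open import Data.Nat.Properties
open import Data.Nat.Tactic.RingSolver using (solve-∀)
open import Data.Bool using (Bool; true; false; if_then_else_; not; _xor_)
open import Data.Bool.Properties as Bool using (not-involutive; T-≡; ¬-not)
open import Data.Fin using (Fin; zero; suc; toℕ; fromℕ<; punchIn; punchOut)
import Data.Fin.Properties as Fin
open import Data.Fin.Subset as Subset using (Subset; _⊆_; ⊤; ⊥; ⁅_⁆; _∪_)
import Data.Fin.Subset.Properties as Subset
open import Data.List as List
  using (List; []; _∷_; _++_; _∷ʳ_; length; foldl; reverse; filter; concatMap;
         cartesianProductWith; cartesianProduct; allFin)
import Data.List.Properties as List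
open import Data.List.Membership.Propositional using (_∈_; find; lose)
open import Data.List.Membership.Propositional.Properties
open import Data.List.Relation.Unary.All as All using (All; []; _∷_)
import Data.List.Relation.Unary.All.Properties as All
open import Data.List.Relation.Unary.AllPairs as AllPairs using (AllPairs; []; _∷_)
import Data.List.Relation.Unary.AllPairs.Properties as AllPairs
open import Data.List.Relation.Unary.Any as Any using (here; there)
open import Data.List.Relation.Unary.Unique.Propositional using (Unique)
import Data.List.Relation.Unary.Unique.Propositional.Properties as Unique
open import Data.Product using (∃; _×_; _,_; proj₁; proj₂)
open import Data.Sum as Sum using (_⊎_; inj₁; inj₂)
open import Data.Vec using (Vec; []; _∷_; tabulate; lookup; map; here; there)
import Data.Vec.Properties as Vec
open import Data.Vec.Relation.Unary.All as VAll using ([]; _∷_)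
import Data.Vec.Relation.Unary.All.Properties as VAll
open import Data.Vec.Relation.Unary.AllPairs as VAllPairs using ([]; _∷_)
import Data.Vec.Relation.Unary.AllPairs.Properties as VAllPairs
open import Function using (_∘_)
open import Function.Bundles using (Equivalence)
open import Relation.Binary.PropositionalEquality
  using (_≡_; _≢_; refl; sym; trans; cong; cong₂; subst; subst₂; module ≡-Reasoning)
open import Relation.Nullary using (¬_; Dec; yes; no; does; contradiction)
open import Relation.Nullary.Decidable using (dec-true)

-- The obstacle is a matter of sides. `desc` reads right descents off a window, whereas the atoms of
-- [u, w] are left descents of u⁻¹w, that is, right descents of its inverse. Inverses of windows are
-- never formed: an element is carried by a word and its inverse by the reversed word, and
-- `reverse-cong` makes this independent of the word. The step to w = u w_J does not rest on the
-- lattice property of the weak order. Commuting left descents of u⁻¹w can be stripped off at the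
-- cost of one unit of length each, which puts u w_J below w. For the converse, an element between u
-- and u w_J is reached by a prefix of a reduced word of w_J. A descent of a product occurs in every
-- word for it, so only letters of J can be stripped from the right end. The same fact recovers J
-- from w_J, so no interval is counted twice.

private variable
  m n : ℕ
  b : Bool

-- Signed values, the action of the generators, and the nodes of the diagram

true≢false : b ≡ true → b ≢ false
true≢false refl ()

neg : SVal m → SVal m
neg (b , j) = not b , j

neg-involutive : (x : SVal m) → neg (neg x) ≡ x
neg-involutive (b , j) = cong (_, j) (not-involutive b)

-- The order 1 < 2 < ⋯ < m < -m < ⋯ < -1, for which the identity window
-- (1, …, m) followed by its negated reversal is increasing.
infix 4 _≻_
_≻_ : SVal m → SVal m → Bool
(false , i) ≻ (false , j) = toℕ j <ᵇ toℕ i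
(false , _) ≻ (true  , _) = false
(true  , _) ≻ (false , _) = true
(true  , i) ≻ (true  , j) = toℕ i <ᵇ toℕ j

-- The number n of entries is kept apart from the number m of values, so that a tail is again an
-- admissible argument. The last node is the one reached when a single entry is left.
act : Fin n → Vec (SVal m) n → Vec (SVal m) n
act zero    (x ∷ [])     = neg x ∷ []
act zero    (x ∷ y ∷ w)  = y ∷ x ∷ w
act (suc i) (x ∷ w)      = x ∷ act i w

-- The neighbour of the last entry x in the doubled window is `neg x`, and `x ≻ neg x` holds exactly
-- when x is negative.
desc : Fin n → Vec (SVal m) n → Bool
desc zero    (x ∷ [])    = proj₁ x
desc zero    (x ∷ y ∷ _) = x ≻ y
desc (suc i) (_ ∷ w)     = desc i w

-- Inversions of (w₁, …, wₙ, -wₙ, …, -w₁), counting each symmetric pair of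
-- inversions once.
bit : Bool → ℕ
bit b = if b then 1 else 0

cross : SVal m → SVal m → ℕ
cross x y = bit (x ≻ y) + bit (x ≻ neg y)

crosses : SVal m → Vec (SVal m) n → ℕ
crosses x []      = 0
crosses x (y ∷ w) = cross x y + crosses x w

inv : Vec (SVal m) n → ℕ
inv []      = 0
inv (x ∷ w) = bit (proj₁ x) + crosses x w + inv w

_#_ : SVal m → SVal m → Set
x # y = proj₂ x ≢ proj₂ y

Distinct : Vec (SVal m) n → Set
Distinct = VAllPairs.AllPairs _#_

-- Nodes at distance at least two, whose generators commute. The inductive form follows the
-- recursion of `act` and `desc`.
data Apart : Fin n → Fin n → Set where
  lo : {j : Fin n} → Apart zero (suc (suc j))
  hi : {j : Fin n} → Apart (suc (suc j)) zero
  up : {i j : Fin n} → Apart i j → Apart (suc i) (suc j)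

data Adjacent : Fin n → Fin n → Set where
  next : Adjacent {suc (suc n)} zero (suc zero)
  up   : {i j : Fin n} → Adjacent i j → Adjacent (suc i) (suc j)

data Position (i j : Fin n) : Set where
  same  : i ≡ j → Position i j
  apart : Apart i j → Position i j
  below : Adjacent i j → Position i j
  above : Adjacent j i → Position i j

position : (i j : Fin n) → Position i j
position zero          zero          = same refl
position zero          (suc zero)    = below next
position zero          (suc (suc j)) = apart lo
position (suc zero)    zero          = above next
position (suc (suc i)) zero          = apart hi
position (suc i)       (suc j) with position i j
... | same refl = same refl
... | apart a   = apart (up a)
... | below a   = below (up a)
... | above a   = above (up a)

Apart-sym : {i j : Fin n} → Apart i j → Apart j i
Apart-sym lo     = hi
Apart-sym hi     = lo
Apart-sym (up a) = up (Apart-sym a)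

Apart-irrefl : {i : Fin n} → ¬ Apart i i
Apart-irrefl (up a) = Apart-irrefl a

act-involutive : (i : Fin n) (w : Vec (SVal m) n) → act i (act i w) ≡ w
act-involutive zero    (x ∷ [])    = cong (_∷ []) (neg-involutive x)
act-involutive zero    (x ∷ y ∷ w) = refl
act-involutive (suc i) (x ∷ w)     = cong (x ∷_) (act-involutive i w)

act-comm : {i j : Fin n} → Apart i j → (w : Vec (SVal m) n) →
  act i (act j w) ≡ act j (act i w)
act-comm lo     (x ∷ y ∷ w) = refl
act-comm hi     (x ∷ y ∷ w) = refl
act-comm (up a) (x ∷ w)     = cong (x ∷_) (act-comm a w)

desc-act-apart : {i j : Fin n} → Apart i j → (w : Vec (SVal m) n) →
  desc i (act j w) ≡ desc i w
desc-act-apart lo                       (x ∷ y ∷ w)     = refl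
desc-act-apart (hi {j = zero})          (x ∷ y ∷ z ∷ []) = refl
desc-act-apart (hi {j = zero})          (x ∷ y ∷ z ∷ _ ∷ w) = refl
desc-act-apart (hi {j = suc j})         (x ∷ y ∷ z ∷ w) = refl
desc-act-apart (up a)                   (x ∷ w)         = desc-act-apart a w

act-map : (f : SVal m → SVal m) → (∀ x → f (neg x) ≡ neg (f x)) →
  (i : Fin n) (w : Vec (SVal m) n) → act i (map f w) ≡ map f (act i w)
act-map f f-neg zero    (x ∷ [])    = cong (_∷ []) (sym (f-neg x))
act-map f f-neg zero    (x ∷ y ∷ w) = refl
act-map f f-neg (suc i) (x ∷ w)     = cong (f x ∷_) (act-map f f-neg i w)

All-act : {P : SVal m → Set} → (∀ {x} → P x → P (neg x)) →
  (i : Fin n) {w : Vec (SVal m) n} → VAll.All P w → VAll.All P (act i w)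
All-act P-neg zero    {_ ∷ []}    (p ∷ [])     = P-neg p ∷ []
All-act P-neg zero    {_ ∷ _ ∷ _} (p ∷ q ∷ ps) = q ∷ p ∷ ps
All-act P-neg (suc i)             (p ∷ ps)     = p ∷ All-act P-neg i ps

Distinct-act : (i : Fin n) {w : Vec (SVal m) n} → Distinct w → Distinct (act i w)
Distinct-act zero {_ ∷ []} ([] ∷ []) = [] ∷ []
Distinct-act zero {_ ∷ _ ∷ _} ((x#y ∷ x#w) ∷ y#w ∷ d) =
  ((x#y ∘ sym) ∷ y#w) ∷ x#w ∷ d
Distinct-act (suc i) (x#w ∷ d) = All-act (λ p → p) i x#w ∷ Distinct-act i d

-- Inversions

<ᵇ-asym : {i j : ℕ} → i ≢ j → (j <ᵇ i) ≡ not (i <ᵇ j)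
<ᵇ-asym {zero}  {zero}  i≢j = contradiction refl i≢j
<ᵇ-asym {zero}  {suc j} i≢j = refl
<ᵇ-asym {suc i} {zero}  i≢j = refl
<ᵇ-asym {suc i} {suc j} i≢j = <ᵇ-asym (i≢j ∘ cong suc)

<ᵇ-true⇒< : {i j : ℕ} → (i <ᵇ j) ≡ true → i < j
<ᵇ-true⇒< {i} {j} p = <ᵇ⇒< i j (Equivalence.from T-≡ p)

<⇒<ᵇ-true : {i j : ℕ} → i < j → (i <ᵇ j) ≡ true
<⇒<ᵇ-true i<j = Equivalence.to T-≡ (<⇒<ᵇ i<j)

<ᵇ-false⇒≥ : {i j : ℕ} → (i <ᵇ j) ≡ false → j ≤ i
<ᵇ-false⇒≥ p = ≮⇒≥ (λ i<j → true≢false (<⇒<ᵇ-true i<j) p)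

≥⇒<ᵇ-false : {i j : ℕ} → j ≤ i → (i <ᵇ j) ≡ false
≥⇒<ᵇ-false j≤i = ¬-not (λ p → ≤⇒≯ j≤i (<ᵇ-true⇒< p))

≻-flip : (x y : SVal m) → x # y → (y ≻ x) ≡ not (x ≻ y)
≻-flip (false , i) (false , j) i≢j = <ᵇ-asym (i≢j ∘ sym ∘ Fin.toℕ-injective)
≻-flip (false , i) (true  , j) i≢j = refl
≻-flip (true  , i) (false , j) i≢j = refl
≻-flip (true  , i) (true  , j) i≢j = <ᵇ-asym (i≢j ∘ Fin.toℕ-injective)

≻-neg : (x y : SVal m) → (x ≻ neg y) ≡ (y ≻ neg x)
≻-neg (false , i) (false , j) = refl
≻-neg (false , i) (true  , j) = refl
≻-neg (true  , i) (false , j) = refl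
≻-neg (true  , i) (true  , j) = refl

≻-trans : (x y z : SVal m) → (x ≻ y) ≡ true → (y ≻ z) ≡ true → (x ≻ z) ≡ true
≻-trans (false , i) (false , j) (false , k) p q =
  <⇒<ᵇ-true (<-trans (<ᵇ-true⇒< {toℕ k} {toℕ j} q) (<ᵇ-true⇒< {toℕ j} {toℕ i} p))
≻-trans (true , i) y (false , k) p q = refl
≻-trans (true , i) (true , j) (true , k) p q =
  <⇒<ᵇ-true (<-trans (<ᵇ-true⇒< {toℕ i} {toℕ j} p) (<ᵇ-true⇒< {toℕ j} {toℕ k} q))

cross-neg : (x y : SVal m) → cross x (neg y) ≡ cross x y
cross-neg x y rewrite neg-involutive y = +-comm (bit (x ≻ neg y)) _

crosses-act : (x : SVal m) (i : Fin n) (w : Vec (SVal m) n) →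
  crosses x (act i w) ≡ crosses x w
crosses-act x zero    (y ∷ [])    = cong (_+ 0) (cross-neg x y)
crosses-act x zero    (y ∷ z ∷ w) = swap (cross x z) (cross x y) (crosses x w)
  where
  swap : ∀ a b c → a + (b + c) ≡ b + (a + c)
  swap = solve-∀
crosses-act x (suc i) (y ∷ w)     = cong (cross x y +_) (crosses-act x i w)

-- Only one pair of entries changes its status. In a swap the truth value of `x ≻ neg y` is
-- symmetric in x and y, so `x ≻ y` alone matters; negating the last entry merely exchanges the two
-- summands of each `cross` with it and changes its own sign bit.
inv-ascent : (i : Fin n) {w : Vec (SVal m) n} → Distinct w →
  desc i w ≡ false → inv (act i w) ≡ suc (inv w)
inv-ascent zero {(false , _) ∷ []} d asc = refl
inv-ascent zero {x ∷ y ∷ w} ((x#y ∷ _) ∷ _) asc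
  rewrite ≻-flip x y x#y | asc | ≻-neg y x =
  swap (bit (proj₁ x)) (bit (proj₁ y)) (bit (x ≻ neg y)) (crosses x w) (crosses y w) (inv w)
  where
  swap : ∀ a b c e f g →
    b + (1 + c + f) + (a + e + g) ≡ suc (a + (0 + c + e) + (b + f + g))
  swap = solve-∀
inv-ascent (suc i) {x ∷ w} (_ ∷ d) asc
  rewrite inv-ascent i d asc | crosses-act x i w =
  +-suc (bit (proj₁ x) + crosses x w) (inv w)

desc-act : (i : Fin n) {w : Vec (SVal m) n} → Distinct w →
  desc i (act i w) ≡ not (desc i w)
desc-act zero    {_ ∷ []}    d               = refl
desc-act zero    {x ∷ y ∷ _} ((x#y ∷ _) ∷ _) = ≻-flip x y x#y
desc-act (suc i) {_ ∷ _}     (_ ∷ d)         = desc-act i d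

inv-descent : (i : Fin n) {w : Vec (SVal m) n} → Distinct w →
  desc i w ≡ true → suc (inv (act i w)) ≡ inv w
inv-descent i {w} d p = trans
  (sym (inv-ascent i (Distinct-act i d) (trans (desc-act i d) (cong not p))))
  (cong inv (act-involutive i w))

inv-act-≤ : (i : Fin n) {w : Vec (SVal m) n} → Distinct w → inv (act i w) ≤ suc (inv w)
inv-act-≤ i {w} d with desc i w in eq
... | false = ≤-reflexive (inv-ascent i d eq)
... | true  = m≤n⇒m≤1+n (≤-trans (n≤1+n _) (≤-reflexive (inv-descent i d eq)))

-- With x ≻ y ≻ z, sorting (x, y, z) takes three steps; at the end of the
-- window z is -y.
adjacent-descents : {i j : Fin n} → Adjacent i j → (w : Vec (SVal m) n) →
  desc i w ≡ true → desc j w ≡ true →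
  desc j (act i w) ≡ true × desc i (act j (act i w)) ≡ true
adjacent-descents next (x@(true , _)  ∷ y@(true , _) ∷ []) p q = refl , refl
adjacent-descents next ((false , _) ∷ (false , _) ∷ []) p ()
adjacent-descents next ((false , _) ∷ (true , _) ∷ []) () q
adjacent-descents next (x ∷ y ∷ z ∷ w) p q = ≻-trans x y z p q , q
adjacent-descents (up a) (x ∷ w) p q = adjacent-descents a w p q

adjacent-descents⇒3≤inv : {i j : Fin n} → Adjacent i j → {w : Vec (SVal m) n} →
  Distinct w → desc i w ≡ true → desc j w ≡ true → 3 ≤ inv w
adjacent-descents⇒3≤inv {i = i} {j} a {w} d p q
  rewrite sym (inv-descent i d p)
        | sym (inv-descent j (Distinct-act i d) (proj₁ (adjacent-descents a w p q)))
        | sym (inv-descent i (Distinct-act j (Distinct-act i d)) (proj₂ (adjacent-descents a w p q)))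
  = s≤s (s≤s (s≤s z≤n))

-- Words in the generators

infixl 5 _·_
_·_ : Vec (SVal m) n → List (Fin n) → Vec (SVal m) n
w · is = foldl (λ v i → act i v) w is

·-++ : (w : Vec (SVal m) n) (xs ys : List (Fin n)) → w · (xs ++ ys) ≡ w · xs · ys
·-++ = List.foldl-++ _

·-∷ʳ : (w : Vec (SVal m) n) (xs : List (Fin n)) (i : Fin n) → w · (xs ∷ʳ i) ≡ act i (w · xs)
·-∷ʳ w xs i = List.foldl-∷ʳ _ w i xs

Distinct-· : {w : Vec (SVal m) n} (xs : List (Fin n)) → Distinct w → Distinct (w · xs)
Distinct-· []       d = d
Distinct-· (i ∷ xs) d = Distinct-· xs (Distinct-act i d)

inv-·-≤ : {w : Vec (SVal m) n} (xs : List (Fin n)) → Distinct w →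
  inv (w · xs) ≤ inv w + length xs
inv-·-≤ {w = w} [] d = ≤-reflexive (sym (+-identityʳ (inv w)))
inv-·-≤ {w = w} (i ∷ xs) d = begin
  inv (act i w · xs)         ≤⟨ inv-·-≤ xs (Distinct-act i d) ⟩
  inv (act i w) + length xs  ≤⟨ +-monoˡ-≤ (length xs) (inv-act-≤ i d) ⟩
  suc (inv w) + length xs    ≡⟨ +-suc (inv w) (length xs) ⟨
  inv w + suc (length xs)    ∎
  where open ≤-Reasoning

·-reverse : (w : Vec (SVal m) n) (xs : List (Fin n)) → w · xs · reverse xs ≡ w
·-reverse w []       = refl
·-reverse w (i ∷ xs) = begin
  act i w · xs · reverse (i ∷ xs)      ≡⟨ cong (act i w · xs ·_) (List.unfold-reverse i xs) ⟩
  act i w · xs · (reverse xs ∷ʳ i)     ≡⟨ ·-∷ʳ (act i w · xs) (reverse xs) i ⟩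
  act i (act i w · xs · reverse xs)    ≡⟨ cong (act i) (·-reverse (act i w) xs) ⟩
  act i (act i w)                      ≡⟨ act-involutive i w ⟩
  w                                    ∎
  where open ≡-Reasoning

reverse-· : (w : Vec (SVal m) n) (xs : List (Fin n)) → w · reverse xs · xs ≡ w
reverse-· w xs = subst (λ ys → w · reverse xs · ys ≡ w) (List.reverse-involutive xs)
  (·-reverse w (reverse xs))

-- The generators as elements of the hyperoctahedral group

lookup-act-swap : (i : Fin n) (1+i<n : suc (toℕ i) < n) (w : Vec (SVal m) n) (j : Fin n) →
  lookup (act i w) j ≡
  lookup w (if toℕ j ≡ᵇ toℕ i then fromℕ< 1+i<n
            else if toℕ j ≡ᵇ suc (toℕ i) then i else j)
lookup-act-swap zero (s≤s ()) (x ∷ [])    j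
lookup-act-swap zero _ (x ∷ y ∷ w) zero          = refl
lookup-act-swap zero _ (x ∷ y ∷ w) (suc zero)    = refl
lookup-act-swap zero _ (x ∷ y ∷ w) (suc (suc j)) = refl
lookup-act-swap (suc i) _ (x ∷ w) zero = refl
lookup-act-swap (suc i) (s≤s p) (x ∷ w) (suc j)
  rewrite lookup-act-swap i p w j with toℕ j ≡ᵇ toℕ i | toℕ j ≡ᵇ suc (toℕ i)
... | true  | _     = refl
... | false | true  = refl
... | false | false = refl

lookup-act-last : (i : Fin n) → ¬ suc (toℕ i) < n → (w : Vec (SVal m) n) (j : Fin n) →
  lookup (act i w) j ≡
  ((if toℕ j ≡ᵇ toℕ i then not (proj₁ (lookup w j)) else proj₁ (lookup w j)) ,
   proj₂ (lookup w j))
lookup-act-last zero    _ (x ∷ [])    zero    = refl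
lookup-act-last zero    ¬p (x ∷ y ∷ w) j      = contradiction (s≤s (s≤s z≤n)) ¬p
lookup-act-last (suc i) _ (x ∷ w)     zero    = refl
lookup-act-last (suc i) ¬p (x ∷ w)    (suc j) = lookup-act-last i (¬p ∘ s≤s) w j

rmul≡act : (w : Window n) (i : Fin n) → rmul w i ≡ act i w
rmul≡act {n} w i with suc (toℕ i) <? n
... | yes p = trans (Vec.tabulate-cong (sym ∘ lookup-act-swap i p w)) (Vec.tabulate∘lookup _)
... | no ¬p = trans (Vec.tabulate-cong (sym ∘ lookup-act-last i ¬p w)) (Vec.tabulate∘lookup _)

eval≡· : (is : List (Fin n)) → eval is ≡ identity · is
eval≡· = List.foldl-cong rmul≡act identity

-- The odd extension of u to signed values. Left multiplication by u relabels values, while the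
-- generators act on positions, so the two commute.
substitute : Window n → SVal n → SVal n
substitute u (b , j) = (b xor proj₁ (lookup u j)) , proj₂ (lookup u j)

substitute-neg : (u : Window n) (x : SVal n) → substitute u (neg x) ≡ neg (substitute u x)
substitute-neg u (false , j) = refl
substitute-neg u (true  , j) = cong (_, proj₂ (lookup u j)) (sym (not-involutive _))

compose≡map : (u v : Window n) → compose u v ≡ map (substitute u) v
compose≡map u v = trans (Vec.tabulate-∘ (substitute u) (lookup v))
  (cong (map (substitute u)) (Vec.tabulate∘lookup v))

map-· : (f : SVal m → SVal m) → (∀ x → f (neg x) ≡ neg (f x)) →
  (w : Vec (SVal m) n) (xs : List (Fin n)) → map f w · xs ≡ map f (w · xs)
map-· f f-neg w []       = refl
map-· f f-neg w (i ∷ xs) = trans (cong (_· xs) (act-map f f-neg i w)) (map-· f f-neg (act i w) xs)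

compose-· : (u : Window n) (xs : List (Fin n)) → compose u (identity · xs) ≡ u · xs
compose-· u xs = begin
  compose u (identity · xs)           ≡⟨ compose≡map u (identity · xs) ⟩
  map (substitute u) (identity · xs)  ≡⟨ map-· _ (substitute-neg u) identity xs ⟨
  map (substitute u) identity · xs    ≡⟨ cong (_· xs) map-identity ⟩
  u · xs                              ∎
  where
  open ≡-Reasoning
  map-identity : map (substitute u) identity ≡ u
  map-identity = trans (sym (Vec.tabulate-∘ (substitute u) (false ,_))) (Vec.tabulate∘lookup u)

Distinct-lookup : {w : Vec (SVal m) n} → Distinct w → {i j : Fin n} →
  proj₂ (lookup w i) ≡ proj₂ (lookup w j) → i ≡ j
Distinct-lookup (_ ∷ _)    {zero}  {zero}  _  = refl
Distinct-lookup (x#w ∷ _)  {zero}  {suc j} eq = contradiction eq (VAll.lookup⁺ x#w j)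
Distinct-lookup (x#w ∷ _)  {suc i} {zero}  eq = contradiction (sym eq) (VAll.lookup⁺ x#w i)
Distinct-lookup (_ ∷ d)    {suc i} {suc j} eq = cong suc (Distinct-lookup d eq)

xor-cancelʳ : (a b c : Bool) → (a xor c) ≡ (b xor c) → a ≡ b
xor-cancelʳ false false c     eq = refl
xor-cancelʳ true  true  c     eq = refl
xor-cancelʳ false true  true  ()
xor-cancelʳ false true  false ()
xor-cancelʳ true  false true  ()
xor-cancelʳ true  false false ()

substitute-injective : {u : Window n} → Distinct u → {x y : SVal n} →
  substitute u x ≡ substitute u y → x ≡ y
substitute-injective {u = u} d {b , j} {c , k} eq with Distinct-lookup d {j} {k} (cong proj₂ eq)
... | refl = cong (_, j) (xor-cancelʳ b c _ (cong proj₁ eq))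

map-injective : {A B : Set} {f : A → B} → (∀ {x y} → f x ≡ f y → x ≡ y) →
  {v w : Vec A n} → map f v ≡ map f w → v ≡ w
map-injective f-inj {[]}    {[]}    eq = refl
map-injective f-inj {_ ∷ _} {_ ∷ _} eq =
  cong₂ _∷_ (f-inj (Vec.∷-injectiveˡ eq)) (map-injective f-inj (Vec.∷-injectiveʳ eq))

-- Together with `·-cong-identity`, this lets every comparison of words based at u be made at the
-- identity, where lengths are known.
·-cancelˡ : {u : Window n} → Distinct u → (xs ys : List (Fin n)) →
  u · xs ≡ u · ys → identity · xs ≡ identity · ys
·-cancelˡ {u = u} d xs ys eq = map-injective (substitute-injective d) (begin
  map (substitute u) (identity · xs)  ≡⟨ compose≡map u _ ⟨
  compose u (identity · xs)           ≡⟨ compose-· u xs ⟩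
  u · xs                              ≡⟨ eq ⟩
  u · ys                              ≡⟨ compose-· u ys ⟨
  compose u (identity · ys)           ≡⟨ compose≡map u _ ⟩
  map (substitute u) (identity · ys)  ∎)
  where open ≡-Reasoning

·-cong-identity : (xs ys : List (Fin n)) → identity · xs ≡ identity · ys →
  (u : Window n) → u · xs ≡ u · ys
·-cong-identity xs ys eq u =
  trans (sym (compose-· u xs)) (trans (cong (compose u) eq) (compose-· u ys))

-- Both reversed words undo the same element. This replaces the well-definedness of the inverse.
reverse-cong : (xs ys : List (Fin n)) → identity · xs ≡ identity · ys →
  identity · reverse xs ≡ identity · reverse ys
reverse-cong xs ys eq = begin
  identity · reverse xs                        ≡⟨ cong (_· reverse xs) (reverse-· identity ys) ⟨
  identity · reverse ys · ys · reverse xs      ≡⟨ cong (_· reverse xs) (·-cong-identity xs ys eq _) ⟨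
  identity · reverse ys · xs · reverse xs      ≡⟨ ·-reverse _ xs ⟩
  identity · reverse ys                        ∎
  where open ≡-Reasoning

-- The number of inversions is the word length

Distinct-identity : Distinct (identity {n})
Distinct-identity = VAllPairs.tabulate⁺ (λ i≢j → i≢j)

crosses-tabulate : (x : SVal m) (f : Fin n → SVal m) → (∀ j → cross x (f j) ≡ 0) →
  crosses x (tabulate f) ≡ 0
crosses-tabulate {n = zero}  x f eq = refl
crosses-tabulate {n = suc n} x f eq rewrite eq zero = crosses-tabulate x (f ∘ suc) (eq ∘ suc)

-- The tails of the identity tabulate maps other than the identity, hence the general f.
inv-increasing : (f : Fin n → Fin m) → (∀ {i j} → toℕ i < toℕ j → toℕ (f i) ≤ toℕ (f j)) →
  inv (tabulate (λ j → false , f j)) ≡ 0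
inv-increasing {zero}  f mono = refl
inv-increasing {suc n} f mono
  rewrite crosses-tabulate (false , f zero) (λ j → false , f (suc j))
            (λ j → cong (λ b → bit b + 0) (≥⇒<ᵇ-false (mono {zero} {suc j} (s≤s z≤n))))
  = inv-increasing (f ∘ suc) (mono ∘ s≤s)

inv-identity : (n : ℕ) → inv (identity {n}) ≡ 0
inv-identity n = inv-increasing {n} (λ j → j) <⇒≤

NoDescents : Vec (SVal m) n → Set
NoDescents {n = n} w = (i : Fin n) → desc i w ≡ false

head-<-next : {x y : SVal m} → x # y → (x ≻ y) ≡ false → proj₁ y ≡ false →
  proj₁ x ≡ false × toℕ (proj₂ x) < toℕ (proj₂ y)
head-<-next {x = false , i} {false , j} i≢j eq refl =
  refl , ≤∧≢⇒< (<ᵇ-false⇒≥ eq) (i≢j ∘ Fin.toℕ-injective)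

-- Read from the right: the last entry is positive, and an entry that is not above a positive
-- neighbour is positive and smaller. Each step to the left therefore costs at least one; the bound
-- m - n + i is written without subtraction.
NoDescents-upper : {w : Vec (SVal m) n} → Distinct w → NoDescents w → (i : Fin n) →
  proj₁ (lookup w i) ≡ false × toℕ (proj₂ (lookup w i)) + n ≤ m + toℕ i
NoDescents-upper {m} {w = x ∷ []} d nd zero = nd zero ,
  (begin
    toℕ (proj₂ x) + 1   ≡⟨ +-comm _ 1 ⟩
    suc (toℕ (proj₂ x)) ≤⟨ Fin.toℕ<n (proj₂ x) ⟩
    m                   ≡⟨ +-identityʳ m ⟨
    m + 0               ∎)
  where open ≤-Reasoning
NoDescents-upper {w = x ∷ y ∷ w} ((x#y ∷ _) ∷ d) nd zero
  with y≥0 , y≤ ← NoDescents-upper d (nd ∘ suc) zero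
  with x≥0 , x<y ← head-<-next x#y (nd zero) y≥0
  = x≥0 , ≤-trans (≤-reflexive (+-suc (toℕ (proj₂ x)) _)) (≤-trans (+-monoˡ-≤ _ x<y) y≤)
NoDescents-upper {m} {w = x ∷ w@(_ ∷ _)} (_ ∷ d) nd (suc i)
  with p , q ← NoDescents-upper d (nd ∘ suc) i
  = p , ≤-trans (≤-reflexive (+-suc _ _)) (≤-trans (s≤s q) (≤-reflexive (sym (+-suc m _))))

-- The same strict increase read from the left. For m = n and c = 0 it meets the upper bound at i.
NoDescents-lower : {w : Vec (SVal m) (suc n)} → Distinct w → NoDescents w →
  {c : ℕ} → c ≤ toℕ (proj₂ (lookup w zero)) →
  (i : Fin (suc n)) → c + toℕ i ≤ toℕ (proj₂ (lookup w i))
NoDescents-lower {w = x ∷ w} d nd {c} c≤x zero = ≤-trans (≤-reflexive (+-identityʳ c)) c≤x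
NoDescents-lower {w = x ∷ w@(y ∷ _)} ((x#y ∷ _) ∷ d) nd {c} c≤x (suc i) =
  ≤-trans (≤-reflexive (+-suc c (toℕ i))) (NoDescents-lower d (nd ∘ suc)
    (≤-trans (s≤s c≤x) (proj₂ (head-<-next {x = x} x#y (nd zero) (proj₁ (NoDescents-upper d (nd ∘ suc) zero))))) i)

NoDescents⇒identity : {w : Window n} → Distinct w → NoDescents w → w ≡ identity
NoDescents⇒identity {n} {w} d nd =
  trans (sym (Vec.tabulate∘lookup w)) (Vec.tabulate-cong (pointwise w d nd))
  where
  pointwise : (w : Window n) → Distinct w → NoDescents w → (i : Fin n) → lookup w i ≡ (false , i)
  pointwise w@(_ ∷ _) d nd i = cong₂ _,_ (proj₁ (NoDescents-upper d nd i))
    (Fin.toℕ-injective (≤-antisym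
      (+-cancelʳ-≤ n _ _ (≤-trans (proj₂ (NoDescents-upper d nd i)) (≤-reflexive (+-comm n _))))
      (NoDescents-lower d nd z≤n i)))

desc-identity : NoDescents (identity {n})
desc-identity {n} i with desc i (identity {n}) in eq
... | false = refl
... | true  = contradiction (trans (inv-descent i Distinct-identity eq) (inv-identity n)) λ()

-- Sorting by descents: each step lowers `inv` by one, and only the identity has no descent left.
reduced-word : (w : Window n) → Distinct w →
  ∃ λ xs → identity · xs ≡ w × length xs ≡ inv w
reduced-word {n} w d = go (inv w) w d refl
  where
  go : (l : ℕ) (w : Window n) → Distinct w → inv w ≡ l →
    ∃ λ xs → identity · xs ≡ w × length xs ≡ l
  go l w d eq with Fin.any? (λ i → desc i w Bool.≟ true)
  go l w d eq | no none with refl ← NoDescents⇒identity d (λ i → ¬-not (none ∘ (i ,_))) =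
    [] , refl , trans (sym (inv-identity n)) eq
  go zero    w d eq | yes (i , p) = contradiction (trans (inv-descent i d p) eq) λ()
  go (suc l) w d eq | yes (i , p)
    with xs , xs≡ , len ← go l (act i w) (Distinct-act i d) (suc-injective (trans (inv-descent i d p) eq))
    = xs ∷ʳ i
    , trans (·-∷ʳ identity xs i) (trans (cong (act i) xs≡) (act-involutive i w))
    , trans (List.length-++ xs) (trans (+-comm _ 1) (cong suc len))

inv-≤-length : (xs : List (Fin n)) → inv (identity · xs) ≤ length xs
inv-≤-length {n} xs =
  ≤-trans (inv-·-≤ xs Distinct-identity) (≤-reflexive (cong (_+ length xs) (inv-identity n)))

HasLength-inv : {w : Window n} → Distinct w → HasLength w (inv w)
HasLength-inv {w = w} d with xs , xs≡ , len ← reduced-word w d =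
  (xs , len , trans (eval≡· xs) xs≡) ,
  λ ws ws≡ → subst (λ v → inv v ≤ length ws) (trans (sym (eval≡· ws)) ws≡)
    (inv-≤-length ws)

HasLength⇒Distinct : {w : Window n} {l : ℕ} → HasLength w l → Distinct w
HasLength⇒Distinct ((ws , _ , refl) , _) =
  subst Distinct (sym (eval≡· ws)) (Distinct-· ws Distinct-identity)

HasLength⇒≡inv : {w : Window n} {l : ℕ} → HasLength w l → l ≡ inv w
HasLength⇒≡inv {w = w} h@((ws , refl , ws≡) , minimal)
  with (xs , len , xs≡) , inv-minimal ← HasLength-inv (HasLength⇒Distinct h) =
  ≤-antisym (≤-trans (minimal xs xs≡) (≤-reflexive len)) (inv-minimal ws ws≡)

-- A reduced word read backwards is a word of the same length for the inverse. Applying this twice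
-- gives equality.
inv-reverse-≤ : (xs : List (Fin n)) → inv (identity · reverse xs) ≤ inv (identity · xs)
inv-reverse-≤ xs with ys , ys≡ , len ← reduced-word (identity · xs) (Distinct-· xs Distinct-identity) =
  ≤-trans (subst (λ v → inv v ≤ length (reverse ys)) (reverse-cong ys xs ys≡) (inv-≤-length (reverse ys)))
    (≤-reflexive (trans (List.length-reverse ys) len))

inv-reverse : (xs : List (Fin n)) → inv (identity · reverse xs) ≡ inv (identity · xs)
inv-reverse xs = ≤-antisym (inv-reverse-≤ xs)
  (subst (λ ys → inv (identity · ys) ≤ inv (identity · reverse xs))
    (List.reverse-involutive xs) (inv-reverse-≤ (reverse xs)))

inv-·-≤-inv : {u : Window n} (xs : List (Fin n)) → Distinct u →
  inv (u · xs) ≤ inv u + inv (identity · xs)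
inv-·-≤-inv {u = u} xs d
  with ys , ys≡ , len ← reduced-word (identity · xs) (Distinct-· xs Distinct-identity)
  rewrite sym (·-cong-identity ys xs ys≡ u) | sym len = inv-·-≤ ys d

-- The weak order

-- The word xs stands for u⁻¹w, and the length condition forces it to be reduced. `Distinct u` says
-- that u is a signed permutation.
Weak : Window n → Window n → Set
Weak u w = Distinct u × ∃ λ xs → u · xs ≡ w × inv w ≡ inv u + length xs

≤R⇒Weak : {u w : Window n} → u ≤R w → Weak u w
≤R⇒Weak {u = u} {w} (v , uv≡w , a , b , c , hu , hv@((xs , refl , refl) , _) , hw , c≡a+b) =
  HasLength⇒Distinct hu , xs ,
  trans (sym (compose-· u xs)) (trans (cong (compose u) (sym (eval≡· xs))) uv≡w) ,
  trans (sym (HasLength⇒≡inv hw)) (trans c≡a+b (cong (_+ length xs) (HasLength⇒≡inv hu)))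

Weak⇒≤R : {u w : Window n} → Weak u w → u ≤R w
Weak⇒≤R {u = u} (d , xs , refl , eq) =
  identity · xs , compose-· u xs , inv u , length xs , inv (u · xs) ,
  HasLength-inv d , ((xs , refl , eval≡· xs) , minimal) , HasLength-inv (Distinct-· xs d) , eq
  where
  minimal : (ws : List _) → eval ws ≡ identity · xs → length xs ≤ length ws
  -- A shorter word for u⁻¹w would also lead from u to w, and would not gain enough length.
  minimal ws ws≡ = +-cancelˡ-≤ (inv u) _ _ (begin
    inv u + length xs  ≡⟨ eq ⟨
    inv (u · xs)       ≡⟨ cong inv (·-cong-identity ws xs (trans (sym (eval≡· ws)) ws≡) u) ⟨
    inv (u · ws)       ≤⟨ inv-·-≤ ws d ⟩
    inv u + length ws  ∎)
    where open ≤-Reasoning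

Weak-refl : {u : Window n} → Distinct u → Weak u u
Weak-refl d = d , [] , refl , sym (+-identityʳ _)

Weak-trans : {u v w : Window n} → Weak u v → Weak v w → Weak u w
Weak-trans {u = u} (d , xs , refl , eq) (_ , ys , refl , eq′) =
  d , xs ++ ys , ·-++ u xs ys , (begin
    inv (u · xs · ys)                ≡⟨ eq′ ⟩
    inv (u · xs) + length ys         ≡⟨ cong (_+ length ys) eq ⟩
    inv u + length xs + length ys    ≡⟨ +-assoc (inv u) _ _ ⟩
    inv u + (length xs + length ys)  ≡⟨ cong (inv u +_) (List.length-++ xs) ⟨
    inv u + length (xs ++ ys)        ∎)
  where open ≡-Reasoning

Weak⇒Distinct : {u w : Window n} → Weak u w → Distinct w
Weak⇒Distinct (d , xs , refl , _) = Distinct-· xs d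

Weak⇒inv-≤ : {u w : Window n} → Weak u w → inv u ≤ inv w
Weak⇒inv-≤ (_ , _ , _ , eq) = ≤-trans (m≤m+n _ _) (≤-reflexive (sym eq))

Weak-antisym : {u w : Window n} → Weak u w → Weak w u → u ≡ w
Weak-antisym (_ , []     , eq , _)  _ = eq
Weak-antisym {u = u} {w} (_ , x ∷ xs , _ , eq) wu =
  contradiction (≤-trans (≤-reflexive (sym eq)) (Weak⇒inv-≤ wu)) (m+1+n≰m (inv u))

Weak-ascent : {u : Window n} → Distinct u → {s : Fin n} → desc s u ≡ false → Weak u (act s u)
Weak-ascent {u = u} d {s} asc = d , s ∷ [] , refl , trans (inv-ascent s d asc) (+-comm 1 (inv u))

-- The step is the first letter of a reduced word from u to w. Were it a descent of u, the remaining
-- letters could not make up for the loss of length.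
Weak-step : {u w : Window n} → Weak u w → u ≢ w →
  ∃ λ s → desc s u ≡ false × Weak (act s u) w
Weak-step (d , [] , eq , _) u≢w = contradiction eq u≢w
Weak-step {u = u} {w} (d , s ∷ xs , eq , len) u≢w = s , asc , Distinct-act s d , xs , eq ,
  trans len (trans (+-suc (inv u) (length xs)) (cong (_+ length xs) (sym (inv-ascent s d asc))))
  where
  open ≤-Reasoning
  asc : desc s u ≡ false
  asc = ¬-not λ p → <⇒≱ (begin-strict
    inv w                      ≡⟨ cong inv eq ⟨
    inv (act s u · xs)         ≤⟨ inv-·-≤ xs (Distinct-act s d) ⟩
    inv (act s u) + length xs  <⟨ +-monoˡ-< (length xs) (≤-reflexive (inv-descent s d p)) ⟩
    inv u + length xs          ∎)
    (≤-trans (+-monoʳ-≤ (inv u) (n≤1+n _)) (≤-reflexive (sym len)))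

-- Words in pairwise commuting generators

Commuting : List (Fin n) → Set
Commuting = AllPairs Apart

Ascents Descents : Vec (SVal m) n → List (Fin n) → Set
Ascents  w = All (λ c → desc c w ≡ false)
Descents w = All (λ c → desc c w ≡ true)

desc-· : {c : Fin n} {xs : List (Fin n)} → All (Apart c) xs → (w : Vec (SVal m) n) →
  desc c (w · xs) ≡ desc c w
desc-· []       w = refl
desc-· (a ∷ as) w = trans (desc-· as _) (desc-act-apart a w)

act-· : {c : Fin n} {xs : List (Fin n)} → All (Apart c) xs → (w : Vec (SVal m) n) →
  act c w · xs ≡ act c (w · xs)
act-· []                     w = refl
act-· {xs = x ∷ xs} (a ∷ as) w =
  trans (cong (_· xs) (act-comm (Apart-sym a) w)) (act-· as (act x w))

desc-act-all : {c : Fin n} {w : Vec (SVal m) n} {cs : List (Fin n)} → All (Apart c) cs →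
  All (λ d → desc d w ≡ b) cs → All (λ d → desc d (act c w) ≡ b) cs
desc-act-all []       []       = []
desc-act-all (a ∷ as) (p ∷ ps) = trans (desc-act-apart (Apart-sym a) _) p ∷ desc-act-all as ps

inv-ascents : {w : Vec (SVal m) n} {cs : List (Fin n)} → Distinct w →
  Commuting cs → Ascents w cs → inv (w · cs) ≡ inv w + length cs
inv-ascents d [] [] = sym (+-identityʳ _)
inv-ascents {w = w} {c ∷ cs} d (a ∷ as) (p ∷ ps) = begin
  inv (act c w · cs)         ≡⟨ inv-ascents (Distinct-act c d) as (desc-act-all a ps) ⟩
  inv (act c w) + length cs  ≡⟨ cong (_+ length cs) (inv-ascent c d p) ⟩
  suc (inv w) + length cs    ≡⟨ +-suc (inv w) (length cs) ⟨
  inv w + suc (length cs)    ∎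
  where open ≡-Reasoning

inv-descents : {w : Vec (SVal m) n} {cs : List (Fin n)} → Distinct w →
  Commuting cs → Descents w cs → inv (w · cs) + length cs ≡ inv w
inv-descents d [] [] = +-identityʳ _
inv-descents {w = w} {c ∷ cs} d (a ∷ as) (p ∷ ps) = begin
  inv (act c w · cs) + suc (length cs)    ≡⟨ +-suc _ (length cs) ⟩
  suc (inv (act c w · cs) + length cs)    ≡⟨ cong suc (inv-descents (Distinct-act c d) as (desc-act-all a ps)) ⟩
  suc (inv (act c w))                     ≡⟨ inv-descent c d p ⟩
  inv w                                   ∎
  where open ≡-Reasoning

Weak-ascents : {u : Window n} {cs : List (Fin n)} → Distinct u →
  Commuting cs → Ascents u cs → Weak u (u · cs)
Weak-ascents {cs = cs} d as asc = d , cs , refl , inv-ascents d as asc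

-- By commutation any letter of cs can be pulled to the front.
Weak-member : {u : Window n} {cs : List (Fin n)} → Distinct u → Commuting cs → Ascents u cs →
  {c : Fin n} → c ∈ cs → Weak (act c u) (u · cs)
Weak-member {cs = c ∷ cs} d (a ∷ as) (p ∷ ps) (here refl) =
  Weak-ascents (Distinct-act c d) as (desc-act-all a ps)
Weak-member {u = u} {c ∷ cs} d (a ∷ as) (p ∷ ps) {c′} (there c′∈cs) =
  Weak-trans
    (subst (Weak (act c′ u)) (act-comm (All.lookup a c′∈cs) u)
      (Weak-ascent (Distinct-act c′ d) (trans (desc-act-apart (All.lookup a c′∈cs) u) p)))
    (Weak-member (Distinct-act c d) as (desc-act-all a ps) c′∈cs)

-- The left descents of u⁻¹w are the right descents of its inverse, and that
-- inverse is given by the reversed word.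
reverse-descent : {u w : Window n} {s : Fin n} (xs : List (Fin n)) →
  Distinct u → u · xs ≡ w → inv w ≡ inv u + length xs →
  desc s u ≡ false → Weak (act s u) w →
  desc s (identity · reverse xs) ≡ true
reverse-descent {n} {u} {w} {s} xs d refl len asc (_ , cs , eq , len′) =
  trans (cong (desc s) y≡) (trans (desc-act s dz) (cong not asc-z))
  where
  z : Window n
  z = identity · reverse cs
  dz : Distinct z
  dz = Distinct-· (reverse cs) Distinct-identity
  y≡ : identity · reverse xs ≡ act s z
  y≡ = begin
    identity · reverse xs        ≡⟨ reverse-cong xs (s ∷ cs) (·-cancelˡ d xs (s ∷ cs) (sym eq)) ⟩
    identity · reverse (s ∷ cs)  ≡⟨ cong (identity ·_) (List.unfold-reverse s cs) ⟩
    identity · (reverse cs ∷ʳ s) ≡⟨ ·-∷ʳ identity (reverse cs) s ⟩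
    act s z                      ∎
    where open ≡-Reasoning
  |xs|≡ : length xs ≡ suc (length cs)
  |xs|≡ = +-cancelˡ-≡ (inv u) _ _ (trans (sym len) (trans len′
    (trans (cong (_+ length cs) (inv-ascent s d asc)) (sym (+-suc (inv u) (length cs))))))
  -- A word only bounds `inv` from above. The lower bound comes from u: w lies `length xs` above u,
  -- and by subadditivity u⁻¹w has to supply that much.
  length≤inv : length xs ≤ inv (act s z)
  length≤inv = +-cancelˡ-≤ (inv u) _ _ (begin
    inv u + length xs                      ≡⟨ len ⟨
    inv (u · xs)                           ≤⟨ inv-·-≤-inv xs d ⟩
    inv u + inv (identity · xs)            ≡⟨ cong (inv u +_) (inv-reverse xs) ⟨
    inv u + inv (identity · reverse xs)    ≡⟨ cong (λ v → inv u + inv v) y≡ ⟩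
    inv u + inv (act s z)                  ∎)
    where open ≤-Reasoning
  asc-z : desc s z ≡ false
  -- Were s a descent of z, then `act s z` would be shorter than cs, hence shorter than xs.
  asc-z = ¬-not λ p → <⇒≱ (begin-strict
    inv (act s z)        <⟨ ≤-reflexive (inv-descent s dz p) ⟩
    inv z                ≤⟨ inv-≤-length (reverse cs) ⟩
    length (reverse cs)  ≡⟨ List.length-reverse cs ⟩
    length cs            <⟨ n<1+n _ ⟩
    suc (length cs)      ≡⟨ |xs|≡ ⟨
    length xs            ∎) length≤inv
    where open ≤-Reasoning

inv-reverse-reduced : {u : Window n} (xs : List (Fin n)) → Distinct u →
  inv (u · xs) ≡ inv u + length xs → inv (identity · reverse xs) ≡ length xs
inv-reverse-reduced {u = u} xs d len = trans (inv-reverse xs) (≤-antisym (inv-≤-length xs)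
  (+-cancelˡ-≤ (inv u) _ _ (≤-trans (≤-reflexive (sym len)) (inv-·-≤-inv xs d))))

-- The letters of cs are descents of y, the inverse of u⁻¹w. As they commute, multiplying y by all
-- of them removes exactly `length cs` from its length. A reduced word es for the rest, read
-- backwards, continues from `u · cs` to w with lengths adding up.
Weak-join : {u w : Window n} {cs : List (Fin n)} → Weak u w →
  Commuting cs → Ascents u cs → (∀ {c} → c ∈ cs → Weak (act c u) w) → Weak (u · cs) w
Weak-join {n} {u} {w} {cs} (d , xs , refl , len) as asc atoms≤w
  with es , es≡ , |es| ← reduced-word (identity · reverse xs · cs)
         (Distinct-· cs (Distinct-· (reverse xs) Distinct-identity)) =
  Distinct-· cs d , reverse es , u·cs·es , (begin
    inv (u · xs)                            ≡⟨ len ⟩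
    inv u + length xs                       ≡⟨ cong (inv u +_) |xs|≡ ⟩
    inv u + (length cs + length es)         ≡⟨ +-assoc (inv u) (length cs) (length es) ⟨
    inv u + length cs + length es           ≡⟨ cong (_+ length es) (inv-ascents d as asc) ⟨
    inv (u · cs) + length es                ≡⟨ cong (inv (u · cs) +_) (List.length-reverse es) ⟨
    inv (u · cs) + length (reverse es)      ∎)
  where
  open ≡-Reasoning
  y : Window n
  y = identity · reverse xs
  desc-y : Descents y cs
  desc-y = All.tabulate λ c∈cs → reverse-descent xs d refl len (All.lookup asc c∈cs) (atoms≤w c∈cs)
  |xs|≡ : length xs ≡ length cs + length es
  |xs|≡ = begin
    length xs                 ≡⟨ inv-reverse-reduced xs d len ⟨
    inv y                     ≡⟨ inv-descents (Distinct-· (reverse xs) Distinct-identity) as desc-y ⟨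
    inv (y · cs) + length cs  ≡⟨ cong (_+ length cs) |es| ⟨
    length es + length cs     ≡⟨ +-comm (length es) (length cs) ⟩
    length cs + length es     ∎
  es-cs : identity · (es ++ reverse cs) ≡ y
  es-cs = begin
    identity · (es ++ reverse cs)   ≡⟨ ·-++ identity es (reverse cs) ⟩
    identity · es · reverse cs      ≡⟨ cong (_· reverse cs) es≡ ⟩
    y · cs · reverse cs             ≡⟨ ·-reverse y cs ⟩
    y                               ∎
  x≡ : identity · (cs ++ reverse es) ≡ identity · xs
  x≡ = begin
    identity · (cs ++ reverse es)            ≡⟨ cong (λ zs → identity · (zs ++ reverse es)) (List.reverse-involutive cs) ⟨
    identity · (reverse (reverse cs) ++ reverse es)  ≡⟨ cong (identity ·_) (List.reverse-++ es (reverse cs)) ⟨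
    identity · reverse (es ++ reverse cs)    ≡⟨ reverse-cong (es ++ reverse cs) (reverse xs) es-cs ⟩
    identity · reverse (reverse xs)          ≡⟨ cong (identity ·_) (List.reverse-involutive xs) ⟩
    identity · xs                            ∎
  u·cs·es : u · cs · reverse es ≡ u · xs
  u·cs·es = trans (sym (·-++ u cs (reverse es))) (·-cong-identity (cs ++ reverse es) xs x≡ u)

-- The inverse of u⁻¹w has length two and both i and j as descents.
rank-two⇒Apart : {u w : Window n} {i j : Fin n} → Distinct u → i ≢ j →
  desc i u ≡ false → desc j u ≡ false → Weak u w → inv w ≡ inv u + 2 →
  Weak (act i u) w → Weak (act j u) w → Apart i j
rank-two⇒Apart {n} {u} {i = i} {j} d i≢j asc-i asc-j (_ , xs , refl , len) two iw jw
  with position i j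
... | same i≡j = contradiction i≡j i≢j
... | apart a  = a
... | below a  = contradiction (adjacent-descents⇒3≤inv a (Distinct-· (reverse xs) Distinct-identity)
                   (reverse-descent xs d refl len asc-i iw) (reverse-descent xs d refl len asc-j jw))
                   (<⇒≱ (s≤s (≤-reflexive (trans (inv-reverse-reduced xs d len)
                     (+-cancelˡ-≡ (inv u) _ _ (trans (sym len) two))))))
... | above a  = contradiction (adjacent-descents⇒3≤inv a (Distinct-· (reverse xs) Distinct-identity)
                   (reverse-descent xs d refl len asc-j jw) (reverse-descent xs d refl len asc-i iw))
                   (<⇒≱ (s≤s (≤-reflexive (trans (inv-reverse-reduced xs d len)
                     (+-cancelˡ-≡ (inv u) _ _ (trans (sym len) two))))))

-- A word without the generator s keeps the positions up to s occupied by the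
-- positive values up to s.
data Split (c : ℕ) : Fin n → Vec (SVal m) n → Set where
  last : {j : Fin m} {w : Vec (SVal m) n} → toℕ j ≤ c →
    VAll.All (λ y → c < toℕ (proj₂ y)) w → Split c zero ((false , j) ∷ w)
  next : {s : Fin n} {j : Fin m} {w : Vec (SVal m) n} → toℕ j ≤ c →
    Split c s w → Split c (suc s) ((false , j) ∷ w)

Split-act : {c : ℕ} {s : Fin n} {w : Vec (SVal m) n} → Split c s w →
  (t : Fin n) → t ≢ s → Split c s (act t w)
Split-act (last _ _)            zero    t≢s = contradiction refl t≢s
Split-act (last p ps)           (suc t) t≢s = last p (All-act (λ q → q) t ps)
Split-act (next p (last q qs))  zero    t≢s = next q (last p qs)
Split-act (next p (next q sp))  zero    t≢s = next q (next p sp)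
Split-act (next p sp)           (suc t) t≢s = next p (Split-act sp t (t≢s ∘ cong suc))

-- At position s stands a positive value at most c, and every later entry is negative or larger than
-- c.
Split-desc : {c : ℕ} {s : Fin n} {w : Vec (SVal m) n} → Split c s w → desc s w ≡ false
Split-desc (last p [])                      = refl
Split-desc (last {w = (false , _) ∷ _} p (q ∷ _)) = ≥⇒<ᵇ-false (≤-trans p (<⇒≤ q))
Split-desc (last {w = (true  , _) ∷ _} p (q ∷ _)) = refl
Split-desc (next p sp)                      = Split-desc sp

Split-· : {c : ℕ} {s : Fin n} {w : Vec (SVal m) n} → Split c s w →
  (ts : List (Fin n)) → All (_≢ s) ts → Split c s (w · ts)
Split-· sp []       []         = sp
Split-· sp (t ∷ ts) (t≢s ∷ ps) = Split-· (Split-act sp t t≢s) ts ps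

-- For f the identity, the cut lies at the value s itself; an increasing f is needed for the tails.
Split-tabulate : (f : Fin n → Fin m) (s : Fin n) → (∀ {i j} → toℕ i < toℕ j → toℕ (f i) < toℕ (f j)) →
  Split (toℕ (f s)) s (tabulate (λ j → false , f j))
Split-tabulate f zero    mono = last ≤-refl (VAll.tabulate⁺ (λ j → mono {zero} {suc j} (s≤s z≤n)))
Split-tabulate f (suc s) mono =
  next (<⇒≤ (mono {zero} {suc s} (s≤s z≤n))) (Split-tabulate (f ∘ suc) s (mono ∘ s≤s))

-- A word that avoids s preserves `Split` at s, which excludes a descent there. Thus every word for
-- an element contains all its descents.
desc-·⇒∈ : (s : Fin n) (ts : List (Fin n)) → desc s (identity · ts) ≡ true → s ∈ ts
desc-·⇒∈ s ts p with Any.any? (s Fin.≟_) ts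
... | yes s∈ts = s∈ts
... | no  s∉ts = contradiction (Split-desc (Split-· (Split-tabulate (λ j → j) s (λ q → q)) ts
                   (All.tabulate λ t∈ts t≡s → s∉ts (subst (_∈ ts) t≡s t∈ts)))) (true≢false p)

-- Subwords of commuting words

sel : (cs : List (Fin n)) → Subset (length cs) → List (Fin n)
sel []       []          = []
sel (c ∷ cs) (true  ∷ S) = c ∷ sel cs S
sel (c ∷ cs) (false ∷ S) = sel cs S

All-sel : {P : Fin n → Set} {cs : List (Fin n)} → All P cs →
  (S : Subset (length cs)) → All P (sel cs S)
All-sel []       []          = []
All-sel (p ∷ ps) (true  ∷ S) = p ∷ All-sel ps S
All-sel (p ∷ ps) (false ∷ S) = All-sel ps S

Commuting-sel : {cs : List (Fin n)} → Commuting cs →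
  (S : Subset (length cs)) → Commuting (sel cs S)
Commuting-sel []       []          = []
Commuting-sel (a ∷ as) (true  ∷ S) = All-sel a S ∷ Commuting-sel as S
Commuting-sel (a ∷ as) (false ∷ S) = Commuting-sel as S

sel-⊤ : (cs : List (Fin n)) → sel cs ⊤ ≡ cs
sel-⊤ []       = refl
sel-⊤ (c ∷ cs) = cong (c ∷_) (sel-⊤ cs)

descs : Vec (SVal m) n → (cs : List (Fin n)) → Subset (length cs)
descs w []       = []
descs w (c ∷ cs) = desc c w ∷ descs w cs

-- A chosen letter turns its own ascent into a descent, and the other letters are too far away to
-- affect it. The subset can thus be read off the window.
descs-sel : {u : Vec (SVal m) n} {cs : List (Fin n)} → Distinct u → Commuting cs → Ascents u cs →
  (S : Subset (length cs)) → descs (u · sel cs S) cs ≡ S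
descs-sel d []       []       []          = refl
descs-sel {u = u} {c ∷ cs} d (a ∷ as) (p ∷ ps) (true ∷ S) = cong₂ _∷_
  (trans (desc-· (All-sel a S) (act c u)) (trans (desc-act c d) (cong not p)))
  (descs-sel (Distinct-act c d) as (desc-act-all a ps) S)
descs-sel {u = u} {c ∷ cs} d (a ∷ as) (p ∷ ps) (false ∷ S) = cong₂ _∷_
  (trans (desc-· (All-sel a S) u) p)
  (descs-sel d as ps S)

Weak-sel-mono : {u : Window n} {cs : List (Fin n)} → Distinct u → Commuting cs → Ascents u cs →
  {S S′ : Subset (length cs)} → S ⊆ S′ → Weak (u · sel cs S) (u · sel cs S′)
Weak-sel-mono d [] [] {[]} {[]} S⊆S′ = Weak-refl d
Weak-sel-mono {cs = c ∷ cs} d (a ∷ as) (p ∷ ps) {true ∷ S} {true ∷ S′} S⊆S′ =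
  Weak-sel-mono (Distinct-act c d) as (desc-act-all a ps) (Subset.drop-∷-⊆ S⊆S′)
Weak-sel-mono {cs = c ∷ cs} d (a ∷ as) (p ∷ ps) {true ∷ S} {false ∷ S′} S⊆S′ =
  contradiction (S⊆S′ here) λ()
Weak-sel-mono {cs = c ∷ cs} d (a ∷ as) (p ∷ ps) {false ∷ S} {false ∷ S′} S⊆S′ =
  Weak-sel-mono d as ps (Subset.drop-∷-⊆ S⊆S′)
Weak-sel-mono {u = u} {c ∷ cs} d (a ∷ as) (p ∷ ps) {false ∷ S} {true ∷ S′} S⊆S′ =
  -- Here c is new in S′: climb with the other letters, then append c, which commutes to the front
  -- of the word.
  Weak-trans (Weak-sel-mono d as ps (Subset.drop-∷-⊆ S⊆S′))
    (subst (Weak (u · sel cs S′)) (sym (act-· (All-sel a S′) u))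
      (Weak-ascent (Distinct-· (sel cs S′) d) (trans (desc-· (All-sel a S′) u) p)))

sel-remove : {cs : List (Fin n)} → Commuting cs → (T : Subset (length cs)) {c : Fin n} →
  c ∈ sel cs T → ∃ λ T′ → T′ ⊆ T × length (sel cs T) ≡ suc (length (sel cs T′)) ×
  ((u : Window n) → u · sel cs T ≡ act c (u · sel cs T′))
sel-remove [] [] ()
sel-remove (a ∷ as) (true ∷ T) (here refl) =
  false ∷ T , Subset.out⊆ (λ x → x) , refl , act-· (All-sel a T)
sel-remove {cs = c ∷ _} (a ∷ as) (true ∷ T) (there c∈)
  with T′ , T′⊆T , len , eq ← sel-remove as T c∈ =
  true ∷ T′ , Subset.s⊆s T′⊆T , cong suc len , λ u → eq (act c u)
sel-remove (a ∷ as) (false ∷ T) c∈ with T′ , T′⊆T , len , eq ← sel-remove as T c∈ =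
  false ∷ T′ , Subset.s⊆s T′⊆T , len , eq

-- A product of distinct commuting generators has length `length (sel cs T)`. Since xs is shorter
-- than that, its last extension by b must raise the length, so b is a descent of the product.
desc-last : {cs : List (Fin n)} → Commuting cs → (T : Subset (length cs)) (xs : List (Fin n)) (b : Fin n) →
  identity · (xs ∷ʳ b) ≡ identity · sel cs T → length xs < length (sel cs T) → b ∈ sel cs T
desc-last {n} {cs} as T xs b eq len = desc-·⇒∈ b (sel cs T)
  (trans (cong (desc b) (sym act-xs)) (trans (desc-act b dxs) (cong not asc-xs)))
  where
  act-xs : act b (identity · xs) ≡ identity · sel cs T
  act-xs = trans (sym (·-∷ʳ identity xs b)) eq
  dxs : Distinct (identity · xs)
  dxs = Distinct-· xs Distinct-identity
  open ≤-Reasoning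
  asc-xs : desc b (identity · xs) ≡ false
  asc-xs = ¬-not λ p → <⇒≱ (begin-strict
    inv (identity · xs)               ≤⟨ inv-≤-length xs ⟩
    length xs                         <⟨ len ⟩
    length (sel cs T)                 ≡⟨ cong (_+ length (sel cs T)) (inv-identity n) ⟨
    inv (identity {n}) + length (sel cs T)
      ≡⟨ inv-ascents Distinct-identity (Commuting-sel as T) (All.universal desc-identity _) ⟨
    inv (identity · sel cs T)         ≡⟨ cong inv act-xs ⟨
    inv (act b (identity · xs))       ∎)
    (≤-trans (n≤1+n _) (≤-reflexive (inv-descent b dxs p)))

-- Removing the letters of bs from the right end one at a time, each of them is
-- a descent of a product of generators in cs, hence one of these generators.
prefix-sel : {cs : List (Fin n)} → Commuting cs → (xs bs : List (Fin n)) (T : Subset (length cs)) →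
  identity · (xs ++ reverse bs) ≡ identity · sel cs T →
  length xs + length bs ≡ length (sel cs T) →
  ∃ λ S → S ⊆ T × identity · xs ≡ identity · sel cs S
prefix-sel as xs [] T eq len =
  T , (λ x → x) , trans (cong (identity ·_) (sym (List.++-identityʳ xs))) eq
prefix-sel {cs = cs} as xs (b ∷ bs) T eq len = S , (λ x → T′⊆T (S⊆T′ x)) , xs≡
  where
  ys = xs ++ reverse bs
  |ys| : length ys ≡ length xs + length bs
  |ys| = trans (List.length-++ xs) (cong (length xs +_) (List.length-reverse bs))
  ys∷ʳb : identity · (ys ∷ʳ b) ≡ identity · sel cs T
  ys∷ʳb = trans (cong (identity ·_) (trans (List.++-assoc xs (reverse bs) (b ∷ []))
    (cong (xs ++_) (sym (List.unfold-reverse b bs))))) eq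
  1+len : suc (length xs + length bs) ≡ length (sel cs T)
  1+len = trans (sym (+-suc (length xs) (length bs))) len
  removed = sel-remove as T (desc-last as T ys b ys∷ʳb (≤-reflexive (trans (cong suc |ys|) 1+len)))
  T′ = proj₁ removed
  T′⊆T : T′ ⊆ T
  T′⊆T = proj₁ (proj₂ removed)
  ys≡ : identity · ys ≡ identity · sel cs T′
  ys≡ = begin
    identity · ys                              ≡⟨ act-involutive b _ ⟨
    act b (act b (identity · ys))              ≡⟨ cong (act b) (·-∷ʳ identity ys b) ⟨
    act b (identity · (ys ∷ʳ b))               ≡⟨ cong (act b) ys∷ʳb ⟩
    act b (identity · sel cs T)                ≡⟨ cong (act b) (proj₂ (proj₂ (proj₂ removed)) identity) ⟩
    act b (act b (identity · sel cs T′))       ≡⟨ act-involutive b _ ⟩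
    identity · sel cs T′                       ∎
    where open ≡-Reasoning
  ih = prefix-sel as xs bs T′ ys≡ (suc-injective (trans 1+len (proj₁ (proj₂ (proj₂ removed)))))
  S = proj₁ ih
  S⊆T′ : S ⊆ T′
  S⊆T′ = proj₁ (proj₂ ih)
  xs≡ : identity · xs ≡ identity · sel cs S
  xs≡ = proj₂ (proj₂ ih)

-- The cube above u spanned by a commuting set of ascents

module Cube {u : Window n} {cs : List (Fin n)} (d : Distinct u) (as : Commuting cs) (asc : Ascents u cs) where

  vertex : Subset (length cs) → Window n
  vertex S = u · sel cs S

  label : Window n → Subset (length cs)
  label v = descs v cs

  label-vertex : (S : Subset (length cs)) → label (vertex S) ≡ S
  label-vertex = descs-sel d as asc

  vertex-mono : {S T : Subset (length cs)} → S ⊆ T → Weak (vertex S) (vertex T)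
  vertex-mono = Weak-sel-mono d as asc

  bottom : (S : Subset (length cs)) → Weak u (vertex S)
  bottom S = Weak-ascents d (Commuting-sel as S) (All-sel asc S)

  vertex-⊤ : vertex ⊤ ≡ u · cs
  vertex-⊤ = cong (u ·_) (sel-⊤ cs)

  open ≡-Reasoning

  -- With T the full set, every element of the interval is a vertex. With T the label of v′, the
  -- relation v ≤ v′ yields inclusion of labels.
  below-vertex : {v : Window n} (T : Subset (length cs)) → Weak u v → Weak v (vertex T) →
    ∃ λ S → S ⊆ T × v ≡ vertex S
  below-vertex T (_ , xs , refl , len) (_ , bs , eq , len′)
    -- `prefix-sel` takes its second word reversed, so bs is reversed twice.
    with S , S⊆T , xs≡ ← prefix-sel as xs (reverse bs) T
           (·-cancelˡ d (xs ++ reverse (reverse bs)) (sel cs T)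
             (trans (·-++ u xs (reverse (reverse bs)))
               (trans (cong (u · xs ·_) (List.reverse-involutive bs)) eq)))
           (+-cancelˡ-≡ (inv u) _ _ (begin
             inv u + (length xs + length (reverse bs))  ≡⟨ cong (λ l → inv u + (length xs + l)) (List.length-reverse bs) ⟩
             inv u + (length xs + length bs)            ≡⟨ +-assoc (inv u) (length xs) (length bs) ⟨
             inv u + length xs + length bs              ≡⟨ cong (_+ length bs) len ⟨
             inv (u · xs) + length bs                   ≡⟨ len′ ⟨
             inv (vertex T)                             ≡⟨ inv-ascents d (Commuting-sel as T) (All-sel asc T) ⟩
             inv u + length (sel cs T)                  ∎))
    = S , S⊆T , ·-cong-identity xs (sel cs S) xs≡ u

  isBoolean : IsBooleanInterval (length cs) u (u · cs)
  isBoolean = Weak⇒≤R (Weak-ascents d as asc) , label , vertex ,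
    (λ S → Weak⇒≤R (bottom S) , Weak⇒≤R (subst (Weak (vertex S)) vertex-⊤ (vertex-mono (Subset.⊆-max S)))) ,
    label-vertex ,
    (λ v u≤v v≤w → vertex-label (≤R⇒Weak u≤v) (≤R⇒Weak v≤w)) ,
    λ v v′ u≤v v≤w u≤v′ v′≤w →
      let eq  = vertex-label (≤R⇒Weak u≤v)  (≤R⇒Weak v≤w)
          eq′ = vertex-label (≤R⇒Weak u≤v′) (≤R⇒Weak v′≤w)
      in (λ v≤v′ → label-mono (≤R⇒Weak u≤v) eq′ (≤R⇒Weak v≤v′)) ,
         (λ S⊆T → Weak⇒≤R (subst₂ Weak eq eq′ (vertex-mono S⊆T)))
    where
    vertex-label : {v : Window n} → Weak u v → Weak v (u · cs) → vertex (label v) ≡ v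
    vertex-label {v} u≤v v≤w
      with S , _ , refl ← below-vertex ⊤ u≤v (subst (Weak v) (sym vertex-⊤) v≤w) =
      cong vertex (label-vertex S)
    label-mono : {v v′ : Window n} → Weak u v → vertex (label v′) ≡ v′ → Weak v v′ → label v ⊆ label v′
    label-mono {v} {v′} u≤v eq′ v≤v′
      with S , S⊆T , refl ← below-vertex (label v′) u≤v (subst (Weak v) (sym eq′) v≤v′) =
      subst (_⊆ label v′) (sym (label-vertex S)) S⊆T

-- Counting in lists without repetition

Unique-⊆⇒length-≤ : {A : Set} {xs ys : List A} → Unique xs → (∀ {x} → x ∈ xs → x ∈ ys) →
  length xs ≤ length ys
Unique-⊆⇒length-≤ [] xs⊆ys = z≤n
Unique-⊆⇒length-≤ {xs = x ∷ xs} (x∉xs ∷ u) xs⊆ys with as , bs , refl ← ∈-∃++ (xs⊆ys (here refl)) =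
  ≤-trans (s≤s (Unique-⊆⇒length-≤ u avoid)) (≤-reflexive (begin
    suc (length (as ++ bs))          ≡⟨ cong suc (List.length-++ as) ⟩
    suc (length as + length bs)      ≡⟨ +-suc (length as) (length bs) ⟨
    length as + suc (length bs)      ≡⟨ List.length-++ as ⟨
    length (as ++ x ∷ bs)            ∎))
  where
  open ≡-Reasoning
  avoid : ∀ {y} → y ∈ xs → y ∈ as ++ bs
  avoid y∈xs with ∈-++⁻ as (xs⊆ys (there y∈xs))
  ... | inj₁ y∈as          = ∈-++⁺ˡ y∈as
  ... | inj₂ (here y≡x)    = contradiction (sym y≡x) (All.lookup x∉xs y∈xs)
  ... | inj₂ (there y∈bs)  = ∈-++⁺ʳ as y∈bs

length-filter-split : {A : Set} (p : A → Bool) (xs : List A) →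
  length (filter (λ x → p x Bool.≟ false) xs) + length (filter (λ x → p x Bool.≟ true) xs) ≡ length xs
length-filter-split p []       = refl
length-filter-split p (x ∷ xs) with p x
... | false = cong suc (length-filter-split p xs)
... | true  = trans (+-suc _ _) (cong suc (length-filter-split p xs))

-- An involution that flips p pairs the elements on which p is false with those
-- on which p is true.
length-filter-half : {A : Set} (p : A → Bool) (φ : A → A) → (∀ x → φ (φ x) ≡ x) →
  {xs : List A} → Unique xs → (∀ {x} → x ∈ xs → φ x ∈ xs) →
  (∀ {x} → x ∈ xs → p (φ x) ≡ not (p x)) →
  2 * length (filter (λ x → p x Bool.≟ false) xs) ≡ length xs
length-filter-half {A} p φ φφ {xs} u closed flip = begin
  2 * length (part false)                    ≡⟨ cong (length (part false) +_) (+-identityʳ _) ⟩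
  length (part false) + length (part false)  ≡⟨ cong (length (part false) +_) (≤-antisym (half false) (half true)) ⟩
  length (part false) + length (part true)   ≡⟨ length-filter-split p xs ⟩
  length xs                                  ∎
  where
  open ≡-Reasoning
  part : Bool → List A
  part b = filter (λ x → p x Bool.≟ b) xs
  φ-injective : ∀ {x y} → φ x ≡ φ y → x ≡ y
  φ-injective {x} {y} eq = trans (sym (φφ x)) (trans (cong φ eq) (φφ y))
  half : (b : Bool) → length (part b) ≤ length (part (not b))
  half b = ≤-trans (≤-reflexive (sym (List.length-map φ (part b))))
    (Unique-⊆⇒length-≤ (Unique.map⁺ φ-injective (Unique.filter⁺ (λ x → p x Bool.≟ b) u)) moved)
    where
    moved : ∀ {y} → y ∈ List.map φ (part b) → y ∈ part (not b)
    moved y∈ with x , x∈part , refl ← ∈-map⁻ φ y∈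
             with x∈xs , px ← ∈-filter⁻ (λ x → p x Bool.≟ b) {xs = xs} x∈part =
      ∈-filter⁺ (λ x → p x Bool.≟ not b) (closed x∈xs) (trans (flip x∈xs) (cong not px))

-- Subsets of the path without two neighbours

elems : Vec Bool n → List (Fin n)
elems []          = []
elems (true  ∷ J) = zero ∷ List.map suc (elems J)
elems (false ∷ J) = List.map suc (elems J)

∈-elems⁺ : (J : Vec Bool n) {s : Fin n} → lookup J s ≡ true → s ∈ elems J
∈-elems⁺ (true  ∷ J) {zero}  p = here refl
∈-elems⁺ (true  ∷ J) {suc s} p = there (∈-map⁺ suc (∈-elems⁺ J p))
∈-elems⁺ (false ∷ J) {suc s} p = ∈-map⁺ suc (∈-elems⁺ J p)

∈-elems⁻ : (J : Vec Bool n) {s : Fin n} → s ∈ elems J → lookup J s ≡ true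
∈-elems⁻ (true  ∷ J) (here refl) = refl
∈-elems⁻ (true  ∷ J) (there s∈) with _ , t∈ , refl ← ∈-map⁻ suc s∈ = ∈-elems⁻ J t∈
∈-elems⁻ (false ∷ J) s∈         with _ , t∈ , refl ← ∈-map⁻ suc s∈ = ∈-elems⁻ J t∈

-- A chosen node forces the next one out, unless it ends the path. The two recursive cases are those
-- of Pascal's rule along a diagonal.
data Sparse : Vec Bool n → ℕ → Set where
  []   : Sparse [] 0
  skip : {J : Vec Bool n} {k : ℕ} → Sparse J k → Sparse (false ∷ J) k
  last : Sparse (true ∷ []) 1
  take : {J : Vec Bool n} {k : ℕ} → Sparse J k → Sparse (true ∷ false ∷ J) (suc k)

Sparse⇒Commuting : {J : Vec Bool n} {k : ℕ} → Sparse J k → Commuting (elems J)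
Sparse⇒Commuting []       = []
Sparse⇒Commuting (skip s) = AllPairs.map⁺ (AllPairs.map up (Sparse⇒Commuting s))
Sparse⇒Commuting last     = [] ∷ []
Sparse⇒Commuting (take s) =
  All.map⁺ (All.map⁺ (All.universal (λ _ → lo) _)) ∷
  AllPairs.map⁺ (AllPairs.map⁺ (AllPairs.map (λ a → up (up a)) (Sparse⇒Commuting s)))

Sparse⇒length : {J : Vec Bool n} {k : ℕ} → Sparse J k → length (elems J) ≡ k
Sparse⇒length []                 = refl
Sparse⇒length (skip {J = J} s)   = trans (List.length-map suc (elems J)) (Sparse⇒length s)
Sparse⇒length last               = refl
Sparse⇒length (take {J = J} s)   = cong suc (trans (List.length-map suc (List.map suc (elems J)))
  (trans (List.length-map suc (elems J)) (Sparse⇒length s)))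

Apart-pred : {i j : Fin n} → Apart (suc i) (suc j) → Apart i j
Apart-pred (up a) = a

pairwise-Apart⇒Sparse : (J : Vec Bool n) →
  (∀ {s t} → lookup J s ≡ true → lookup J t ≡ true → s ≢ t → Apart s t) → ∃ (Sparse J)
pairwise-Apart⇒Sparse []          ap = 0 , []
pairwise-Apart⇒Sparse (false ∷ J) ap
  with k , s ← pairwise-Apart⇒Sparse J (λ p q ne → Apart-pred (ap p q (ne ∘ Fin.suc-injective))) =
  k , skip s
pairwise-Apart⇒Sparse (true ∷ []) ap = 1 , last
pairwise-Apart⇒Sparse (true ∷ false ∷ J) ap
  with k , s ← pairwise-Apart⇒Sparse J (λ p q ne →
         Apart-pred (Apart-pred (ap p q (ne ∘ Fin.suc-injective ∘ Fin.suc-injective)))) =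
  suc k , take s
pairwise-Apart⇒Sparse (true ∷ true ∷ J) ap = contradiction (ap {zero} {suc zero} refl refl λ()) λ()

sparse : (n k : ℕ) → List (Vec Bool n)
sparse zero          zero          = [] ∷ []
sparse zero          (suc k)       = []
sparse (suc n)       zero          = List.map (false ∷_) (sparse n zero)
sparse (suc zero)    (suc zero)    = (true ∷ []) ∷ []
sparse (suc zero)    (suc (suc k)) = []
sparse (suc (suc n)) (suc k)       =
  List.map (false ∷_) (sparse (suc n) (suc k)) ++ List.map (λ J → true ∷ false ∷ J) (sparse n k)

∈-sparse⁺ : {J : Vec Bool n} {k : ℕ} → Sparse J k → J ∈ sparse n k
∈-sparse⁺ [] = here refl
∈-sparse⁺ {k = zero} (skip s) = ∈-map⁺ (false ∷_) (∈-sparse⁺ s)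
∈-sparse⁺ {k = suc k} (skip {n = suc n} s) = ∈-++⁺ˡ (∈-map⁺ (false ∷_) (∈-sparse⁺ s))
∈-sparse⁺ last = here refl
∈-sparse⁺ (take s) = ∈-++⁺ʳ _ (∈-map⁺ (λ J → true ∷ false ∷ J) (∈-sparse⁺ s))

∈-sparse⁻ : (n k : ℕ) {J : Vec Bool n} → J ∈ sparse n k → Sparse J k
∈-sparse⁻ zero          zero    (here refl) = []
∈-sparse⁻ (suc n)       zero    J∈ with _ , J′∈ , refl ← ∈-map⁻ (false ∷_) J∈ = skip (∈-sparse⁻ n zero J′∈)
∈-sparse⁻ (suc zero)    (suc zero) (here refl) = last
∈-sparse⁻ (suc (suc n)) (suc k) J∈ with ∈-++⁻ (List.map (false ∷_) (sparse (suc n) (suc k))) J∈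
... | inj₁ J∈′ with _ , J′∈ , refl ← ∈-map⁻ (false ∷_) J∈′ = skip (∈-sparse⁻ (suc n) (suc k) J′∈)
... | inj₂ J∈′ with _ , J′∈ , refl ← ∈-map⁻ (λ J → true ∷ false ∷ J) J∈′ = take (∈-sparse⁻ n k J′∈)

Unique-sparse : (n k : ℕ) → Unique (sparse n k)
Unique-sparse zero          zero          = [] ∷ []
Unique-sparse zero          (suc k)       = []
Unique-sparse (suc n)       zero          = Unique.map⁺ Vec.∷-injectiveʳ (Unique-sparse n zero)
Unique-sparse (suc zero)    (suc zero)    = [] ∷ []
Unique-sparse (suc zero)    (suc (suc k)) = []
Unique-sparse (suc (suc n)) (suc k)       = Unique.++⁺
  (Unique.map⁺ Vec.∷-injectiveʳ (Unique-sparse (suc n) (suc k)))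
  (Unique.map⁺ (Vec.∷-injectiveʳ ∘ Vec.∷-injectiveʳ) (Unique-sparse n k))
  disjoint
  where
  disjoint : ∀ {J} → ¬ (J ∈ List.map (false ∷_) (sparse (suc n) (suc k)) ×
                        J ∈ List.map (λ J → true ∷ false ∷ J) (sparse n k))
  disjoint (J∈ , J∈′) with _ , _ , refl ← ∈-map⁻ (false ∷_) J∈
                      with _ , _ , () ← ∈-map⁻ (λ J → true ∷ false ∷ J) J∈′

length-sparse-0 : (n : ℕ) → length (sparse n 0) ≡ 1
length-sparse-0 zero    = refl
length-sparse-0 (suc n) = trans (List.length-map (false ∷_) (sparse n 0)) (length-sparse-0 n)

diagonal-pascal : (a k : ℕ) → (a ∸ k) C k + (a ∸ k) C suc k ≡ (suc a ∸ k) C suc k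
diagonal-pascal a k with k ≤? a
diagonal-pascal a k       | yes k≤a =
  trans (nCk+nC[k+1]≡[n+1]C[k+1] (a ∸ k) k) (cong (_C suc k) (sym (+-∸-assoc 1 k≤a)))
diagonal-pascal a zero    | no  k≰a = contradiction z≤n k≰a
-- Past the diagonal, truncated subtraction turns every term into 0 choose a positive number.
diagonal-pascal a (suc k) | no  k≰a with s≤s a≤k ← ≰⇒> k≰a
  rewrite m≤n⇒m∸n≡0 a≤k | m≤n⇒m∸n≡0 (m≤n⇒m≤1+n a≤k) = refl

length-sparse : (n k : ℕ) → length (sparse n k) ≡ (n + 1 ∸ k) C k
length-sparse n             zero          = length-sparse-0 n
length-sparse zero          (suc zero)    = refl
length-sparse zero          (suc (suc k)) = refl
length-sparse (suc zero)    (suc zero)    = refl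
length-sparse (suc zero)    (suc (suc zero)) = refl
length-sparse (suc zero)    (suc (suc (suc k))) = refl
length-sparse (suc (suc n)) (suc k)       = begin
  length (List.map (false ∷_) A ++ List.map (λ J → true ∷ false ∷ J) B)
    ≡⟨ List.length-++ (List.map (false ∷_) A) ⟩
  length (List.map (false ∷_) A) + length (List.map (λ J → true ∷ false ∷ J) B)
    ≡⟨ cong₂ _+_ (List.length-map (false ∷_) A) (List.length-map (λ J → true ∷ false ∷ J) B) ⟩
  length A + length B
    ≡⟨ cong₂ _+_ (length-sparse (suc n) (suc k)) (length-sparse n k) ⟩
  (n + 1 ∸ k) C suc k + (n + 1 ∸ k) C k
    ≡⟨ +-comm ((n + 1 ∸ k) C suc k) _ ⟩
  (n + 1 ∸ k) C k + (n + 1 ∸ k) C suc k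
    ≡⟨ diagonal-pascal (n + 1) k ⟩
  (suc (n + 1) ∸ k) C suc k
    ∎
  where
  open ≡-Reasoning
  A = sparse (suc n) (suc k)
  B = sparse n k

-- The atoms of a Boolean interval

module Boolean {k : ℕ} {u w : Window n} (boolean : IsBooleanInterval k u w) where

  u≤w : Weak u w
  u≤w = ≤R⇒Weak (proj₁ boolean)

  d : Distinct u
  d = proj₁ u≤w

  f : Window n → Subset k
  f = proj₁ (proj₂ boolean)

  g : Subset k → Window n
  g = proj₁ (proj₂ (proj₂ boolean))

  u≤g : (S : Subset k) → Weak u (g S)
  u≤g S = ≤R⇒Weak (proj₁ (proj₁ (proj₂ (proj₂ (proj₂ boolean))) S))

  g≤w : (S : Subset k) → Weak (g S) w
  g≤w S = ≤R⇒Weak (proj₂ (proj₁ (proj₂ (proj₂ (proj₂ boolean))) S))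

  f-g : (S : Subset k) → f (g S) ≡ S
  f-g = proj₁ (proj₂ (proj₂ (proj₂ (proj₂ boolean))))

  module _ {v v′ : Window n} (u≤v : Weak u v) (v≤w : Weak v w) (u≤v′ : Weak u v′) (v′≤w : Weak v′ w) where
    private
      order = proj₂ (proj₂ (proj₂ (proj₂ (proj₂ (proj₂ boolean))))) v v′
        (Weak⇒≤R u≤v) (Weak⇒≤R v≤w) (Weak⇒≤R u≤v′) (Weak⇒≤R v′≤w)

    f-mono : Weak v v′ → f v ⊆ f v′
    f-mono v≤v′ = proj₁ order (Weak⇒≤R v≤v′)

    f-reflect : f v ⊆ f v′ → Weak v v′
    f-reflect fv⊆fv′ = ≤R⇒Weak (proj₂ order fv⊆fv′)

  g-mono : {S T : Subset k} → S ⊆ T → Weak (g S) (g T)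
  g-mono {S} {T} S⊆T = f-reflect (u≤g S) (g≤w S) (u≤g T) (g≤w T)
    (subst₂ _⊆_ (sym (f-g S)) (sym (f-g T)) S⊆T)

  g-⊥ : g ⊥ ≡ u
  g-⊥ = sym (Weak-antisym (u≤g ⊥)
    (f-reflect (u≤g ⊥) (g≤w ⊥) (Weak-refl d) u≤w (subst (_⊆ f u) (sym (f-g ⊥)) (Subset.⊆-min (f u)))))

  -- If T adds one element i to S, then `g T` is one generator above `g S`: the first step v towards
  -- `g T` has a label between S and T, and the label cannot be S because v is longer than `g S`.
  cover : {S T : Subset k} (i : Fin k) → S ⊆ T → i Subset.∈ T → i Subset.∉ S →
    (∀ {x} → x Subset.∈ T → x Subset.∈ S ⊎ x ≡ i) →
    ∃ λ s → desc s (g S) ≡ false × act s (g S) ≡ g T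
  cover {S} {T} i S⊆T i∈T i∉S split
    with s , asc , v≤gT ← Weak-step (g-mono S⊆T)
           (λ eq → i∉S (subst (i Subset.∈_) (trans (sym (f-g T)) (trans (cong f (sym eq)) (f-g S))) i∈T)) =
    s , asc , Weak-antisym v≤gT (f-reflect (u≤g T) (g≤w T) u≤v v≤w
      (subst (_⊆ f v) (sym (f-g T)) T⊆fv))
    where
    v = act s (g S)
    gS≤v : Weak (g S) v
    gS≤v = Weak-ascent (proj₁ (g≤w S)) asc
    u≤v : Weak u v
    u≤v = Weak-trans (u≤g S) gS≤v
    v≤w : Weak v w
    v≤w = Weak-trans v≤gT (g≤w T)
    S⊆fv : S ⊆ f v
    S⊆fv = subst (_⊆ f v) (f-g S) (f-mono (u≤g S) (g≤w S) u≤v v≤w gS≤v)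
    fv⊆T : f v ⊆ T
    fv⊆T = subst (f v ⊆_) (f-g T) (f-mono u≤v v≤w (u≤g T) (g≤w T) v≤gT)
    i∈fv : i Subset.∈ f v
    i∈fv with i Subset.∈? f v
    ... | yes i∈ = i∈
    ... | no  i∉ = contradiction
      (Weak⇒inv-≤ (f-reflect u≤v v≤w (u≤g S) (g≤w S) (subst (f v ⊆_) (sym (f-g S)) fv⊆S)))
      (<⇒≱ (≤-reflexive (sym (inv-ascent s (proj₁ (g≤w S)) asc))))
      where
      fv⊆S : f v ⊆ S
      fv⊆S x∈fv with split (fv⊆T x∈fv)
      ... | inj₁ x∈S  = x∈S
      ... | inj₂ refl = contradiction x∈fv i∉
    T⊆fv : T ⊆ f v
    T⊆fv x∈T with split x∈T
    ... | inj₁ x∈S  = S⊆fv x∈S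
    ... | inj₂ refl = i∈fv

  atom-cover : (i : Fin k) → ∃ λ s → desc s (g ⊥) ≡ false × act s (g ⊥) ≡ g ⁅ i ⁆
  atom-cover i = cover i (Subset.⊆-min ⁅ i ⁆) (Subset.x∈⁅x⁆ i) Subset.∉⊥
    (inj₂ ∘ Subset.x∈⁅y⁆⇒x≡y i)

  atom : Fin k → Fin n
  atom i = proj₁ (atom-cover i)

  atom-ascent : (i : Fin k) → desc (atom i) u ≡ false
  atom-ascent i = subst (λ v → desc (atom i) v ≡ false) g-⊥ (proj₁ (proj₂ (atom-cover i)))

  act-atom : (i : Fin k) → act (atom i) u ≡ g ⁅ i ⁆
  act-atom i = trans (cong (act (atom i)) (sym g-⊥)) (proj₂ (proj₂ (atom-cover i)))

  atom-injective : {i j : Fin k} → atom i ≡ atom j → i ≡ j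
  atom-injective {i} {j} eq = Subset.x∈⁅y⁆⇒x≡y j (subst (i Subset.∈_) ⁅i⁆≡⁅j⁆ (Subset.x∈⁅x⁆ i))
    where
    ⁅i⁆≡⁅j⁆ : ⁅ i ⁆ ≡ ⁅ j ⁆
    ⁅i⁆≡⁅j⁆ = trans (sym (f-g ⁅ i ⁆)) (trans
      (cong f (trans (sym (act-atom i)) (trans (cong (λ s → act s u) eq) (act-atom j))))
      (f-g ⁅ j ⁆))

  -- The vertex of {i, j} is two covers above u and lies above both atoms, so the rank two case
  -- applies.
  atoms-Apart : {i j : Fin k} → i ≢ j → Apart (atom i) (atom j)
  atoms-Apart {i} {j} i≢j
    with t , asc , eq ← cover j (Subset.p⊆p∪q ⁅ j ⁆) (Subset.x∈p∪q⁺ (inj₂ (Subset.x∈⁅x⁆ j)))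
           (i≢j ∘ sym ∘ Subset.x∈⁅y⁆⇒x≡y i)
           (λ x∈ → Sum.map₂ (Subset.x∈⁅y⁆⇒x≡y j) (Subset.x∈p∪q⁻ ⁅ i ⁆ ⁅ j ⁆ x∈)) =
    rank-two⇒Apart d (i≢j ∘ atom-injective) (atom-ascent i) (atom-ascent j) (u≤g (⁅ i ⁆ ∪ ⁅ j ⁆))
      rank
      (subst (λ v → Weak v (g (⁅ i ⁆ ∪ ⁅ j ⁆))) (sym (act-atom i)) (g-mono (Subset.p⊆p∪q ⁅ j ⁆)))
      (subst (λ v → Weak v (g (⁅ i ⁆ ∪ ⁅ j ⁆))) (sym (act-atom j)) (g-mono (Subset.q⊆p∪q ⁅ i ⁆ ⁅ j ⁆)))
    where
    open ≡-Reasoning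
    rank : inv (g (⁅ i ⁆ ∪ ⁅ j ⁆)) ≡ inv u + 2
    rank = begin
      inv (g (⁅ i ⁆ ∪ ⁅ j ⁆))   ≡⟨ cong inv eq ⟨
      inv (act t (g ⁅ i ⁆))     ≡⟨ inv-ascent t (proj₁ (g≤w ⁅ i ⁆)) asc ⟩
      suc (inv (g ⁅ i ⁆))       ≡⟨ cong (suc ∘ inv) (act-atom i) ⟨
      suc (inv (act (atom i) u)) ≡⟨ cong suc (inv-ascent (atom i) d (atom-ascent i)) ⟩
      2 + inv u                 ≡⟨ +-comm 2 (inv u) ⟩
      inv u + 2                 ∎

  isAtom? : (s : Fin n) → Dec (∃ λ i → atom i ≡ s)
  isAtom? s = Fin.any? (λ i → atom i Fin.≟ s)

  -- A characteristic vector forgets how the isomorphism f numbers the atoms, so J depends on the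
  -- interval alone.
  J : Vec Bool n
  J = tabulate (does ∘ isAtom?)

  lookup-J⁺ : (i : Fin k) → lookup J (atom i) ≡ true
  lookup-J⁺ i = trans (Vec.lookup∘tabulate (does ∘ isAtom?) (atom i)) (dec-true (isAtom? (atom i)) (i , refl))

  lookup-J⁻ : {s : Fin n} → lookup J s ≡ true → ∃ λ i → atom i ≡ s
  lookup-J⁻ {s} p with isAtom? s | trans (sym (Vec.lookup∘tabulate (does ∘ isAtom?) s)) p
  ... | yes a | _ = a

  elems-J : {s : Fin n} → s ∈ elems J → ∃ λ i → atom i ≡ s
  elems-J = lookup-J⁻ ∘ ∈-elems⁻ J

  J-sparse : ∃ (Sparse J)
  J-sparse = pairwise-Apart⇒Sparse J apart-J
    where
    apart-J : ∀ {s t} → lookup J s ≡ true → lookup J t ≡ true → s ≢ t → Apart s t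
    apart-J p q s≢t with i , refl ← lookup-J⁻ p | j , refl ← lookup-J⁻ q =
      atoms-Apart (s≢t ∘ cong atom)

  commuting : Commuting (elems J)
  commuting = Sparse⇒Commuting (proj₂ J-sparse)

  Commuting⇒Unique : {cs : List (Fin n)} → Commuting cs → Unique cs
  Commuting⇒Unique = AllPairs.map λ { a refl → Apart-irrefl a }

  length-elems-J : length (elems J) ≡ k
  length-elems-J = trans (≤-antisym
      (Unique-⊆⇒length-≤ (Commuting⇒Unique commuting) λ s∈ →
        let i , atom≡ = elems-J s∈ in subst (_∈ List.tabulate atom) atom≡ (∈-tabulate⁺ i))
      (Unique-⊆⇒length-≤ (Unique.tabulate⁺ atom-injective) λ s∈ →
        let i , ≡atom = ∈-tabulate⁻ s∈ in subst (_∈ elems J) (sym ≡atom) (∈-elems⁺ J (lookup-J⁺ i))))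
    (List.length-tabulate atom)

  sparse-k : Sparse J k
  sparse-k = subst (Sparse J) (trans (sym (Sparse⇒length (proj₂ J-sparse))) length-elems-J) (proj₂ J-sparse)

  ascents : Ascents u (elems J)
  ascents = All.tabulate λ s∈ → let i , atom≡ = elems-J s∈ in
    subst (λ s → desc s u ≡ false) atom≡ (atom-ascent i)

  -- The join v of the atoms is below w. Conversely the vertices of all singletons lie below v, so
  -- `f v` is the full set, and since f reflects the order, w is below v.
  top : w ≡ u · elems J
  top = Weak-antisym (f-reflect u≤w (Weak-refl (Weak⇒Distinct u≤w)) u≤v v≤w fw⊆fv) v≤w
    where
    v = u · elems J
    u≤v : Weak u v
    u≤v = Weak-ascents d commuting ascents
    v≤w : Weak v w
    v≤w = Weak-join u≤w commuting ascents λ s∈ → let i , atom≡ = elems-J s∈ in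
      subst (λ s → Weak (act s u) w) atom≡ (subst (λ x → Weak x w) (sym (act-atom i)) (g≤w ⁅ i ⁆))
    fw⊆fv : f w ⊆ f v
    fw⊆fv {i} _ = subst (_⊆ f v) (f-g ⁅ i ⁆)
      (f-mono (u≤g ⁅ i ⁆) (g≤w ⁅ i ⁆) u≤v v≤w
        (subst (λ x → Weak x v) (act-atom i)
          (Weak-member d commuting ascents (∈-elems⁺ J (lookup-J⁺ i)))))
      (Subset.x∈⁅x⁆ i)

-- Signed permutations without descents in a given set

-- The values are renumbered so as to skip c. A signed permutation is its first entry followed by a
-- smaller one, renumbered to skip that entry's absolute value.
shift : Fin (suc n) → SVal n → SVal (suc n)
shift c (b , j) = b , punchIn c j

extend : SVal (suc n) → Window n → Window (suc n)
extend x w = x ∷ map (shift (proj₂ x)) w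

values : (n : ℕ) → List (SVal n)
values n = cartesianProduct (false ∷ true ∷ []) (allFin n)

windows : (n : ℕ) → List (Window n)
windows zero    = [] ∷ []
windows (suc n) = cartesianProductWith extend (values (suc n)) (windows n)

extend-injective : {x y : SVal (suc n)} {v w : Window n} → extend x v ≡ extend y w → x ≡ y × v ≡ w
extend-injective {x = x} {y} eq with refl ← Vec.∷-injectiveˡ eq =
  refl , map-injective (λ {a} {b} → shift-injective {a} {b}) (Vec.∷-injectiveʳ eq)
  where
  shift-injective : ∀ {a b} → shift (proj₂ x) a ≡ shift (proj₂ x) b → a ≡ b
  shift-injective eq = cong₂ _,_ (cong proj₁ eq) (Fin.punchIn-injective (proj₂ x) _ _ (cong proj₂ eq))

Unique-windows : (n : ℕ) → Unique (windows n)
Unique-windows zero    = [] ∷ []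
Unique-windows (suc n) = Unique.cartesianProductWith⁺ extend extend-injective
  (Unique.cartesianProduct⁺ (((λ ()) ∷ []) ∷ [] ∷ []) (Unique.allFin⁺ (suc n)))
  (Unique-windows n)

length-cartesianProductWith : {A B C : Set} (f : A → B → C) (xs : List A) (ys : List B) →
  length (cartesianProductWith f xs ys) ≡ length xs * length ys
length-cartesianProductWith f []       ys = refl
length-cartesianProductWith f (x ∷ xs) ys = trans (List.length-++ (List.map (f x) ys))
  (cong₂ _+_ (List.length-map (f x) ys) (length-cartesianProductWith f xs ys))

length-windows : (n : ℕ) → length (windows n) ≡ 2 ^ n * n !
length-windows zero    = refl
length-windows (suc n) = begin
  length (windows (suc n))                      ≡⟨ length-cartesianProductWith extend (values (suc n)) (windows n) ⟩
  length (values (suc n)) * length (windows n)  ≡⟨ cong₂ _*_ |values| (length-windows n) ⟩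
  2 * suc n * (2 ^ n * n !)                     ≡⟨ regroup n (2 ^ n) (n !) ⟩
  2 * 2 ^ n * (suc n * n !)                     ∎
  where
  open ≡-Reasoning
  |values| : length (values (suc n)) ≡ 2 * suc n
  |values| = trans (length-cartesianProductWith _,_ (false ∷ true ∷ []) (allFin (suc n)))
    (cong (2 *_) (List.length-tabulate {n = suc n} (λ j → j)))
  regroup : ∀ a b c → 2 * suc a * (b * c) ≡ 2 * b * (suc a * c)
  regroup = solve-∀

∈-windows⁻ : (n : ℕ) {w : Window n} → w ∈ windows n → Distinct w
∈-windows⁻ zero    (here refl) = []
∈-windows⁻ (suc n) w∈
  with x , v , _ , v∈ , refl ← ∈-cartesianProductWith⁻ extend (values (suc n)) (windows n) w∈ =
  VAll.map⁺ (VAll.universal (λ _ → Fin.punchInᵢ≢i (proj₂ x) _ ∘ sym) v) ∷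
  VAllPairs.map⁺ (VAllPairs.map (λ ne → ne ∘ Fin.punchIn-injective (proj₂ x) _ _) (∈-windows⁻ n v∈))

unshift : {c : Fin (suc n)} {v : Vec (SVal (suc n)) m} → VAll.All (λ y → c ≢ proj₂ y) v →
  ∃ λ v′ → map (shift c) v′ ≡ v
unshift []       = [] , refl
unshift {v = (b , j) ∷ _} (p ∷ ps) with v′ , eq ← unshift ps =
  (b , punchOut p) ∷ v′ , cong₂ _∷_ (cong (b ,_) (Fin.punchIn-punchOut p)) eq

Distinct-unshift : {c : Fin (suc n)} (v : Vec (SVal n) m) → Distinct (map (shift c) v) → Distinct v
Distinct-unshift []      []       = []
Distinct-unshift {c = c} (x ∷ v) (p ∷ ps) =
  VAll.map (λ ne → ne ∘ cong (punchIn c)) (VAll.map⁻ p) ∷ Distinct-unshift v ps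

∈-windows⁺ : {w : Window n} → Distinct w → w ∈ windows n
∈-windows⁺ {zero}  {[]}    [] = here refl
∈-windows⁺ {suc n} {x ∷ w} (p ∷ d) with v , refl ← unshift p =
  ∈-cartesianProductWith⁺ extend
    (∈-cartesianProduct⁺ (bools (proj₁ x)) (∈-allFin (proj₂ x)))
    (∈-windows⁺ (Distinct-unshift v d))
  where
  bools : (b : Bool) → b ∈ false ∷ true ∷ []
  bools false = here refl
  bools true  = there (here refl)

ascending : List (Fin n) → List (Window n)
ascending {n} []       = windows n
ascending     (c ∷ cs) = filter (λ u → desc c u Bool.≟ false) (ascending cs)

∈-ascending⁺ : {u : Window n} {cs : List (Fin n)} → Distinct u → Ascents u cs → u ∈ ascending cs
∈-ascending⁺ d []       = ∈-windows⁺ d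
∈-ascending⁺ {cs = c ∷ _} d (p ∷ ps) = ∈-filter⁺ (λ u → desc c u Bool.≟ false) (∈-ascending⁺ d ps) p

∈-ascending⁻ : {u : Window n} (cs : List (Fin n)) → u ∈ ascending cs → Distinct u × Ascents u cs
∈-ascending⁻ {n} []       u∈ = ∈-windows⁻ n u∈ , []
∈-ascending⁻     (c ∷ cs) u∈
  with u∈′ , p ← ∈-filter⁻ (λ u → desc c u Bool.≟ false) {xs = ascending cs} u∈
  with d , ps ← ∈-ascending⁻ cs u∈′ = d , p ∷ ps

Unique-ascending : (cs : List (Fin n)) → Unique (ascending cs)
Unique-ascending {n} []       = Unique-windows n
Unique-ascending     (c ∷ cs) = Unique.filter⁺ (λ u → desc c u Bool.≟ false) (Unique-ascending cs)

-- As c is apart from cs, `act c` maps `ascending cs` to itself while flipping `desc c`; so each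
-- further filter halves the list.
length-ascending : {cs : List (Fin n)} → Commuting cs →
  2 ^ length cs * length (ascending cs) ≡ 2 ^ n * n !
length-ascending {n} [] = trans (+-identityʳ _) (length-windows n)
length-ascending {n} {c ∷ cs} (a ∷ as) = begin
  2 * 2 ^ length cs * length (ascending (c ∷ cs))    ≡⟨ regroup (2 ^ length cs) _ ⟩
  2 ^ length cs * (2 * length (ascending (c ∷ cs)))  ≡⟨ cong (2 ^ length cs *_) halve ⟩
  2 ^ length cs * length (ascending cs)              ≡⟨ length-ascending as ⟩
  2 ^ n * n !                                        ∎
  where
  open ≡-Reasoning
  regroup : ∀ x y → 2 * x * y ≡ x * (2 * y)
  regroup = solve-∀
  halve : 2 * length (ascending (c ∷ cs)) ≡ length (ascending cs)
  halve = length-filter-half (desc c) (act c) (act-involutive c) (Unique-ascending cs)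
    (λ u∈ → let d , asc = ∈-ascending⁻ cs u∈ in ∈-ascending⁺ (Distinct-act c d) (desc-act-all a asc))
    (λ u∈ → desc-act c (proj₁ (∈-ascending⁻ cs u∈)))

-- Recovering J from the interval, and the list of all Boolean intervals

desc-member : {w : Vec (SVal m) n} {cs : List (Fin n)} → Distinct w → Commuting cs → Ascents w cs →
  {c : Fin n} → c ∈ cs → desc c (w · cs) ≡ true
desc-member {w = w} {c ∷ _} d (a ∷ _) (p ∷ _) (here refl) =
  trans (desc-· a (act c w)) (trans (desc-act c d) (cong not p))
desc-member {cs = c ∷ _} d (a ∷ as) (_ ∷ ps) (there c∈) =
  desc-member (Distinct-act c d) as (desc-act-all a ps) c∈

≡true-antisym : {a b : Bool} → (a ≡ true → b ≡ true) → (b ≡ true → a ≡ true) → a ≡ b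
≡true-antisym {false} {false} f g = refl
≡true-antisym {false} {true}  f g = g refl
≡true-antisym {true}          f g = sym (f refl)

-- J is the descent set of w_J: its members are descents, and every descent occurs in the word.
·-elems-injective : {u : Window n} {I J : Vec Bool n} → Distinct u →
  Commuting (elems I) → Commuting (elems J) → u · elems I ≡ u · elems J → I ≡ J
·-elems-injective {n} {u} {I} {J} d cI cJ eq = begin
  I                     ≡⟨ Vec.tabulate∘lookup I ⟨
  tabulate (lookup I)   ≡⟨ Vec.tabulate-cong (λ s → ≡true-antisym (transfer I J cI eq′) (transfer J I cJ (sym eq′))) ⟩
  tabulate (lookup J)   ≡⟨ Vec.tabulate∘lookup J ⟩
  J                     ∎
  where
  open ≡-Reasoning
  eq′ : identity · elems I ≡ identity · elems J
  eq′ = ·-cancelˡ d (elems I) (elems J) eq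
  transfer : (I J : Vec Bool n) → Commuting (elems I) → identity · elems I ≡ identity · elems J →
    {s : Fin n} → lookup I s ≡ true → lookup J s ≡ true
  transfer I J cI eq {s} p = ∈-elems⁻ J (desc-·⇒∈ s (elems J) (trans (cong (desc s) (sym eq))
    (desc-member Distinct-identity cI (All.universal desc-identity _) (∈-elems⁺ I p))))

Unique-concatMap : {A B : Set} {f : A → List B} {xs : List A} → Unique xs →
  (∀ x → Unique (f x)) →
  (∀ {x y z} → x ∈ xs → y ∈ xs → z ∈ f x → z ∈ f y → x ≡ y) → Unique (concatMap f xs)
Unique-concatMap []          uf disj = []
Unique-concatMap {f = f} {x ∷ xs} (x∉xs ∷ u) uf disj = Unique.++⁺ (uf x)
  (Unique-concatMap u uf (λ x∈ y∈ → disj (there x∈) (there y∈)))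
  λ (z∈fx , z∈) → let y , y∈xs , z∈fy = find-concatMap z∈ in
    All.lookup x∉xs y∈xs (disj (here refl) (there y∈xs) z∈fx z∈fy)
  where
  find-concatMap : ∀ {z} → z ∈ concatMap f xs → ∃ λ y → y ∈ xs × z ∈ f y
  find-concatMap z∈ = find (∈-concatMap⁻ f z∈)

length-concatMap : {A B : Set} {f : A → List B} {l : ℕ} (xs : List A) →
  (∀ {x} → x ∈ xs → length (f x) ≡ l) → length (concatMap f xs) ≡ length xs * l
length-concatMap         []       eq = refl
length-concatMap {f = f} (x ∷ xs) eq =
  trans (List.length-++ (f x)) (cong₂ _+_ (eq (here refl)) (length-concatMap xs (eq ∘ there)))

intervals-of : Vec Bool n → List (Window n × Window n)
intervals-of J = List.map (λ u → u , u · elems J) (ascending (elems J))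

intervals : (n k : ℕ) → List (Window n × Window n)
intervals n k = concatMap intervals-of (sparse n k)

∈-intervals-of⁻ : (J : Vec Bool n) {p : Window n × Window n} → p ∈ intervals-of J →
  Distinct (proj₁ p) × Ascents (proj₁ p) (elems J) × proj₂ p ≡ proj₁ p · elems J
∈-intervals-of⁻ J p∈ with u , u∈ , refl ← ∈-map⁻ (λ u → u , u · elems J) p∈
                     with d , asc ← ∈-ascending⁻ (elems J) u∈ = d , asc , refl

Unique-intervals : (n k : ℕ) → Unique (intervals n k)
Unique-intervals n k = Unique-concatMap (Unique-sparse n k)
  (λ J → Unique.map⁺ (cong proj₁) (Unique-ascending (elems J)))
  λ {I} {J} I∈ J∈ p∈I p∈J →
    let d , _ , eq  = ∈-intervals-of⁻ I p∈I
        _ , _ , eq′ = ∈-intervals-of⁻ J p∈J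
    in ·-elems-injective d (Sparse⇒Commuting (∈-sparse⁻ n k I∈)) (Sparse⇒Commuting (∈-sparse⁻ n k J∈))
         (trans (sym eq) eq′)

length-intervals-of : {k : ℕ} {J : Vec Bool n} → k ≤ n → Sparse J k →
  length (intervals-of J) ≡ 2 ^ (n ∸ k) * n !
length-intervals-of {n} {k} {J} k≤n s = trans (List.length-map _ (ascending (elems J)))
  -- Halving k times gives the count multiplied by 2 ^ k; as k ≤ n, this factor can be split off 2 ^
  -- n and cancelled.
  (*-cancelˡ-≡ _ _ (2 ^ k) {{m^n≢0 2 k}} (begin
    2 ^ k * length (ascending (elems J))                   ≡⟨ cong (λ l → 2 ^ l * length (ascending (elems J))) (Sparse⇒length s) ⟨
    2 ^ length (elems J) * length (ascending (elems J))    ≡⟨ length-ascending (Sparse⇒Commuting s) ⟩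
    2 ^ n * n !                                            ≡⟨ cong (λ l → 2 ^ l * n !) (m+[n∸m]≡n k≤n) ⟨
    2 ^ (k + (n ∸ k)) * n !                                ≡⟨ cong (_* n !) (^-distribˡ-+-* 2 k (n ∸ k)) ⟩
    2 ^ k * 2 ^ (n ∸ k) * n !                              ≡⟨ *-assoc (2 ^ k) _ _ ⟩
    2 ^ k * (2 ^ (n ∸ k) * n !)                            ∎))
  where open ≡-Reasoning

∈-intervals⁺ : {k : ℕ} {u w : Window n} → IsBooleanInterval k u w → (u , w) ∈ intervals n k
∈-intervals⁺ {u = u} boolean = ∈-concatMap⁺ intervals-of (lose (∈-sparse⁺ sparse-k)
  (subst (λ v → (u , v) ∈ intervals-of J) (sym top)
    (∈-map⁺ (λ u → u , u · elems J) (∈-ascending⁺ d ascents))))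
  where open Boolean boolean

∈-intervals⁻ : {k : ℕ} {u w : Window n} → (u , w) ∈ intervals n k → BooleanIntervalC n k (u , w)
∈-intervals⁻ {n} {k} p∈ with J , J∈ , p∈J ← find (∈-concatMap⁻ intervals-of {xs = sparse n k} p∈)
                        with d , asc , refl ← ∈-intervals-of⁻ J p∈J =
  (_ , HasLength-inv d) , (_ , HasLength-inv (Distinct-· (elems J) d)) ,
  subst (λ l → IsBooleanInterval l _ _) (Sparse⇒length s) (Cube.isBoolean d (Sparse⇒Commuting s) asc)
  where s = ∈-sparse⁻ n k J∈

theorem3p8 : (n k : ℕ) → 2 ≤ n → k ≤ n →
    NumberOf (BooleanIntervalC n k) (2 ^ (n ∸ k) * n ! * ((n + 1 ∸ k) C k))
theorem3p8 n k 2≤n k≤n = intervals n k , Unique-intervals n k , count ,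
  λ (u , w) → (λ (_ , _ , boolean) → ∈-intervals⁺ boolean) , ∈-intervals⁻
  where
  open ≡-Reasoning
  count : length (intervals n k) ≡ 2 ^ (n ∸ k) * n ! * ((n + 1 ∸ k) C k)
  count = begin
    length (intervals n k)
      ≡⟨ length-concatMap (sparse n k) (λ J∈ → length-intervals-of k≤n (∈-sparse⁻ n k J∈)) ⟩
    length (sparse n k) * (2 ^ (n ∸ k) * n !)
      ≡⟨ cong (_* (2 ^ (n ∸ k) * n !)) (length-sparse n k) ⟩
    ((n + 1 ∸ k) C k) * (2 ^ (n ∸ k) * n !)
      ≡⟨ *-comm ((n + 1 ∸ k) C k) _ ⟩
    2 ^ (n ∸ k) * n ! * ((n + 1 ∸ k) C k)
      ∎
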